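{- Let $G\ncong K_n$ be a connected graph on $n$ vertices having $p\geq 1$ pendant vertices. Then $$m_{D^{L}(G)}[n,n+p)\leq n-p.$$ For $p=n-1$, equality holds if and only if $G\cong S_n$.
   Context: All graphs are finite, simple and connected. A pendant vertex is a vertex of degree $1$. $K_n$ is the complete graph and $S_n$ the star graph on $n$ vertices. For a connected graph $G$ with vertex set $\{v_1,\dots,v_n\}$, $d_{uv}$ is the length of a shortest path between $u$ and $v$, $D(G)=(d_{uv})$ is the distance matrix, $Tr(v)=\sum_{u\in V(G)}d_{uv}$ is the transmission of $v$, and the distance Laplacian matrix is $D^L(G)=\mathrm{diag}(Tr(v_1),\dots,Tr(v_n))-D(G)$. Its eigenvalues (all real) are the distance Laplacian eigenvalues of $G$. For an interval $I\subseteq\mathbb{R}$, $m_{D^L(G)}I$ denotes the number of distance Laplacian eigenvalues of $G$, counted with multiplicity, lying in $I$. -}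

module Defs where

open import Algebra.Bundles using (CommutativeRing; Semiring)
open import Data.Empty using (⊥-elim)
open import Data.Fin.Base using (Fin; zero; suc; toℕ; punchIn)
open import Data.Fin.Properties using (any?) renaming (_≟_ to _≟ᶠ_)
open import Data.Nat.Base as ℕ using (ℕ; zero; suc; z≤n; s≤s)
import Data.Nat.Properties as ℕₚ
open import Data.Product.Base using (∃; _×_; _,_; proj₁; proj₂)
open import Data.Sum.Base using (_⊎_; inj₁; inj₂; swap)
open import Data.Vec.Base using (count; allFin; tabulate)
open import Data.Vec.Functional using (Vector)
open import Function.Base using (_∘_)
open import Function.Bundles using (_↔_; _⇔_; Inverse)
open import Level using (0ℓ) renaming (suc to lsuc; _⊔_ to _⊔ˡ_)
open import Relation.Binary.Core using (Rel)
open import Relation.Binary.Definitions using (Decidable; Symmetric; Irreflexive)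
import Relation.Binary.Construct.NonStrictToStrict as ToStrict
open import Relation.Binary.PropositionalEquality using (_≡_; _≢_; refl; sym)
open import Relation.Binary.Structures using (IsDecTotalOrder)
open import Relation.Nullary using (¬_; yes; no)
open import Relation.Nullary.Decidable using (map′; ¬?; _×-dec_; _⊎-dec_)
import Relation.Unary as U

record Graph (n : ℕ) : Set₁ where
  field
    Adj    : Rel (Fin n) 0ℓ
    adj?   : Decidable Adj
    adjSym : Symmetric Adj
    adjIrr : Irreflexive _≡_ Adj

open Graph

record _≅_ {m n} (G : Graph m) (H : Graph n) : Set where
  field
    vertices  : Fin m ↔ Fin n
    adjacency : ∀ u v → Adj G u v ⇔ Adj H (Inverse.to vertices u) (Inverse.to vertices v)

infix 4 _≅_

K : ∀ n → Graph n
K n = record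
  { Adj    = _≢_
  ; adj?   = λ u v → ¬? (u ≟ᶠ v)
  ; adjSym = λ u≢v v≡u → u≢v (sym v≡u)
  ; adjIrr = λ u≡v u≢v → u≢v u≡v
  }

-- The vertex with index 0 is the centre.
StarAdj : ∀ {n} → Rel (Fin n) 0ℓ
StarAdj u v = (toℕ u ≡ 0 × toℕ v ≢ 0) ⊎ (toℕ v ≡ 0 × toℕ u ≢ 0)

S : ∀ n → Graph n
S n = record
  { Adj    = StarAdj
  ; adj?   = λ u v → ((toℕ u ℕₚ.≟ 0) ×-dec ¬? (toℕ v ℕₚ.≟ 0))
                  ⊎-dec ((toℕ v ℕₚ.≟ 0) ×-dec ¬? (toℕ u ℕₚ.≟ 0))
  ; adjSym = swap
  ; adjIrr = λ { refl (inj₁ (p , q)) → q p ; refl (inj₂ (p , q)) → q p }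
  }

degree : ∀ {n} → Graph n → Fin n → ℕ
degree {n} G v = count (adj? G v) (allFin n)

Pendant : ∀ {n} → Graph n → Fin n → Set
Pendant G v = degree G v ≡ 1

pendantCount : ∀ {n} → Graph n → ℕ
pendantCount {n} G = count {P = Pendant G} (λ v → degree G v ℕₚ.≟ 1) (allFin n)

-- The last index is the length.
data Walk {n} (G : Graph n) : Fin n → Fin n → ℕ → Set where
  nil  : ∀ {u} → Walk G u u 0
  step : ∀ {u w v k} → Adj G u w → Walk G w v k → Walk G u v (suc k)

Connected : ∀ {n} → Graph n → Set
Connected G = ∀ u v → ∃ (Walk G u v)

walk? : ∀ {n} (G : Graph n) u v → U.Decidable (Walk G u v)
walk? G u v zero = map′ (λ { refl → nil }) (λ { nil → refl }) (u ≟ᶠ v)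
walk? G u v (suc k) =
  map′ (λ { (_ , a , p) → step a p }) (λ { (step a p) → _ , a , p })
       (any? λ w → adj? G u w ×-dec walk? G w v k)

Least : (ℕ → Set) → Set
Least P = ∃ λ k → P k × (∀ j → P j → k ℕ.≤ j)

least : {P : ℕ → Set} → U.Decidable P → ∀ m → P m → Least P
least P? zero    p = 0 , p , λ _ _ → z≤n
least P? (suc m) p with P? 0
... | yes p₀ = 0 , p₀ , λ _ _ → z≤n
... | no ¬p₀ with least (P? ∘ suc) m p
...   | k , pk , min =
        suc k , pk , λ { zero p₀ → ⊥-elim (¬p₀ p₀) ; (suc j) pj → s≤s (min j pj) }

-- A shortest walk never repeats a vertex, so this is the length of a shortest path.
dist : ∀ {n} (G : Graph n) → Connected G → Fin n → Fin n → ℕ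
dist G conn u v = proj₁ (least (walk? G u v) (proj₁ (conn u v)) (proj₂ (conn u v)))

Tr : ∀ {n} (G : Graph n) → Connected G → Fin n → ℕ
Tr G conn v = sum λ u → dist G conn u v
  where open import Algebra.Definitions.RawMonoid ℕ.+-0-rawMonoid using (sum)

-- Ordered fields with decidable order. The real numbers (classically) and the
-- real algebraic numbers (constructively) are instances, and every symmetric
-- integer matrix has all its eigenvalues in either of them.
record OrderedField c ℓ₁ ℓ₂ : Set (lsuc (c ⊔ˡ ℓ₁ ⊔ˡ ℓ₂)) where
  field
    commutativeRing : CommutativeRing c ℓ₁

  open CommutativeRing commutativeRing public hiding (refl; sym; trans; reflexive; zero)

  infix 4 _≤_

  field
    _≤_             : Rel Carrier ℓ₂
    isDecTotalOrder : IsDecTotalOrder _≈_ _≤_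
    0≉1             : ¬ (0# ≈ 1#)
    inverse         : ∀ x → ¬ (x ≈ 0#) → ∃ λ y → x * y ≈ 1#
    +-monoʳ-≤       : ∀ x {y z} → y ≤ z → x + y ≤ x + z
    *-nonNegative   : ∀ {x y} → 0# ≤ x → 0# ≤ y → 0# ≤ x * y

  open IsDecTotalOrder isDecTotalOrder public using (_≟_; _≤?_; antisym)

  open ToStrict _≈_ _≤_ public using (_<_)

  _<?_ : Decidable _<_
  _<?_ = ToStrict.<-decidable _≈_ _≤_ _≟_ _≤?_

module Spectra {c ℓ₁ ℓ₂} (R : OrderedField c ℓ₁ ℓ₂) where

  open OrderedField R
  open import Algebra.Definitions.RawSemiring (Semiring.rawSemiring semiring) using (_^_; sum; product)
    renaming (_×_ to _×ᴿ_)

  fromℕ : ℕ → Carrier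
  fromℕ k = k ×ᴿ 1#

  Matrix : ℕ → Set c
  Matrix n = Fin n → Fin n → Carrier

  -- Laplace expansion along the first row.
  det : ∀ {n} → Matrix n → Carrier
  det {zero}  A = 1#
  det {suc n} A = sum λ j → (- 1#) ^ toℕ j * A zero j * det (λ r s → A (suc r) (punchIn j s))

  diag : ∀ {n} → Vector Carrier n → Matrix n
  diag d i j with i ≟ᶠ j
  ... | yes _ = d i
  ... | no  _ = 0#

  charPoly : ∀ {n} → Matrix n → Carrier → Carrier
  charPoly A x = det λ i j → diag (λ _ → x) i j - A i j

  -- The eigenvalues with algebraic multiplicity: det (x I - A) = ∏ᵢ (x - λᵢ).
  -- An ordered field is infinite, so agreement for all x is equality of
  -- polynomials, and the list of eigenvalues is unique up to reordering.
  record Spectrum {n} (A : Matrix n) : Set (c ⊔ˡ ℓ₁) where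
    field
      eigenvalue : Vector Carrier n
      factors    : ∀ x → charPoly A x ≈ product λ i → x - eigenvalue i

  open Spectrum

  -- m σ [ a , b ⟩ is the number of eigenvalues in the half-open interval [a , b).
  m_[_,_⟩ : ∀ {n} {A : Matrix n} → Spectrum A → Carrier → Carrier → ℕ
  m σ [ a , b ⟩ = count (λ x → (a ≤? x) ×-dec (x <? b)) (tabulate (eigenvalue σ))

  distanceLaplacian : ∀ {n} (G : Graph n) → Connected G → Matrix n
  distanceLaplacian G conn u v =
    diag (λ w → fromℕ (Tr G conn w)) u v - fromℕ (dist G conn u v)

{-# OPTIONS --safe #-}

-- Let L be the distance Laplacian and x a vector supported on the pendant vertices with
-- coordinate sum 0. Pendant vertices are pairwise nonadjacent and have one neighbour each, so
-- d_uv ≥ 2 - a_uv, with a the adjacency matrix, gives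
--   2 xᵀLx = Σ_uv d_uv (x_u - x_v)² ≥ Σ_uv (2 - a_uv) (x_u - x_v)² = 2 (2n - 1) |x|²,
-- whence xᵀLx ≥ (n + p) |x|² on a space of dimension p - 1. So at least p - 1 eigenvalues are
-- at least n + p, and 0 is an eigenvalue too: at most n - p are left for [n, n + p).
-- If p = n - 1, then G is a star with some centre c, and 1 - n e_c is an eigenvector for n.
--
-- An ordered field need not contain the norms of eigenvectors, so instead of orthonormal bases
-- a pair of forms is diagonalised: if B is positive definite and det (x B - A) splits into
-- linear factors, then A and B are weighted sums of squares of the same linear forms, with the
-- roots as the ratios of the weights.
module Submission where

open import Algebra.Bundles using (RawRing; Semiring)
import Algebra.Definitions.RawMonoid
import Algebra.Definitions.RawSemiring
import Algebra.Properties.AbelianGroup as AbelianGroupProperties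
import Algebra.Properties.Group as GroupProperties
import Algebra.Properties.Ring as RingProperties
import Algebra.Properties.Semiring.Mult as SemiringMult
import Algebra.Properties.Semiring.Sum as SemiringSum
import Algebra.Solver.Ring as RingSolver
open import Algebra.Solver.Ring.AlmostCommutativeRing using (fromCommutativeRing; _-Raw-AlmostCommutative⟶_)
open import Data.Bool.Base using (if_then_else_)
open import Data.Fin.Base using (Fin; zero; suc; punchIn; punchOut; inject₁; toℕ)
open import Data.Fin.Induction using (<-weakInduction)
open import Data.Fin.Permutation using (transpose)
import Data.Fin.Permutation.Components as Components
open import Data.Fin.Properties using (suc-injective; punchIn-punchOut; any?; punchIn-injective; punchInᵢ≢i; toℕ-injective) renaming (_≟_ to _≟ᶠ_)
open import Data.List.Base as List using (List; []; _∷_; length; _++_)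
open import Data.List.Membership.Propositional.Properties using (∈-filter⁺; ∈-allFin)
import Data.List.Properties as Listₚ
open import Data.List.Relation.Unary.All as All using (All; []; _∷_)
import Data.List.Relation.Unary.All.Properties as Allₚ
open import Data.Maybe.Base using (Maybe; just; nothing)
open import Data.Nat.Base as ℕ using (ℕ; zero; suc; s≤s; z≤n)
import Data.Nat.Properties as ℕₚ
open import Data.Product.Base using (∃; _×_; _,_; proj₁; proj₂; ∃₂)
open import Data.Sum.Base using (_⊎_; inj₁; inj₂)
open import Data.Vec.Base using (count; tabulate)
open import Data.Vec.Functional as Vector using (insertAt)
import Data.Vec.Functional.Properties as Vectorₚ
open import Defs
open import Function.Base using (_∘_; flip; id; _⟨_⟩_)
open import Function.Bundles using (mk⇔; _⇔_)
open import Function.Construct.Identity using (↔-id)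
import Level
open import Relation.Binary.PropositionalEquality as ≡ using (_≡_; _≢_; _≗_)
open import Relation.Binary.Structures using (IsDecTotalOrder)
open import Relation.Nullary using (¬_; yes; no; does; Dec)
open import Relation.Nullary.Decidable using (¬?; _×-dec_)
open import Relation.Nullary.Negation using (contradiction)
import Relation.Unary as U
import Tactic.RingSolver.Core.AlmostCommutativeRing as Core
import Tactic.RingSolver.NonReflective as AbstractSolver

-- The constant 2n - 1 is the row sum of 2 - a at a vertex of degree one. It is large enough because
-- p < n: two adjacent pendant vertices would be a whole component, that is a complete graph on two
-- vertices, so the neighbour of a pendant vertex is never pendant. The weights 2 - a exceed d on
-- the diagonal, but (x_u - x_v)² vanishes there. The spectrum is given as an identity of functions,
-- det (x I - A) = ∏ (x - λᵢ), so splitting off an eigenvector for μ means dividing such an identity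
-- by x - μ at the point x = μ itself. A difference quotient that is bounded on [0, 1] takes the
-- place of a limit there. The determinant is given by its Laplace expansion, so multiplicativity
-- has to be derived. It rests on a uniqueness principle: an alternating form that vanishes at the
-- standard basis vanishes everywhere. Tracking only the vanishing of forms keeps the signs of
-- permutations out.

-- Ordered fields: a ring solver, order and finite sums

module FieldProperties {c ℓ₁ ℓ₂} (F : OrderedField c ℓ₁ ℓ₂) where

  open OrderedField F public renaming (Carrier to R)
  open Spectra F public using (fromℕ)
  open IsDecTotalOrder isDecTotalOrder public
    using (total)
    renaming (refl to ≤-refl; trans to ≤-trans; reflexive to ≤-reflexive; ≤-respˡ-≈ to ≤-respˡ; ≤-respʳ-≈ to ≤-respʳ)
  open IsDecTotalOrder.Eq isDecTotalOrder public using (refl; sym; trans; reflexive)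
  open RingProperties (OrderedField.ring F) public using (-‿distribˡ-*; -‿distribʳ-*; -1*x≈-x)
  open GroupProperties (OrderedField.+-group F) public using (x∙y⁻¹≈ε⇒x≈y; ⁻¹-involutive; ⁻¹-anti-homo-//; ε⁻¹≈ε)
  open AbelianGroupProperties (OrderedField.+-abelianGroup F) public using (⁻¹-∙-comm)
  open import Relation.Binary.Reasoning.Setoid setoid

  private
    module M = SemiringMult semiring

  -- The integers as reduced formal differences of naturals: with these as coefficients,
  -- unlike with elements of an abstract field, the ring solver recognises x - x as 0.
  module Coefficients where
    reduce : ℕ → ℕ → ℕ × ℕ
    reduce (suc a) (suc b) = reduce a b
    reduce a       b       = a , b

    differences : RawRing _ _
    differences = record
      { Carrier = ℕ × ℕ
      ; _≈_     = _≡_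
      ; _+_     = λ { (a , b) (c , d) → reduce (a ℕ.+ c) (b ℕ.+ d) }
      ; _*_     = λ { (a , b) (c , d) → reduce (a ℕ.* c ℕ.+ b ℕ.* d) (a ℕ.* d ℕ.+ b ℕ.* c) }
      ; -_      = λ { (a , b) → b , a }
      ; 0#      = 0 , 0
      ; 1#      = 1 , 0
      }

    value : ℕ × ℕ → R
    value (a , b) = fromℕ a - fromℕ b

    -- This weaker solver only serves to build the stronger one. It cannot see that x - x is 0, so
    -- cancellation in this module is done by hand.
    open AbstractSolver (Core.fromCommutativeRing commutativeRing (λ _ → nothing))
      using (solve; _⊜_; _⊕_; _⊗_; ⊝_)

    value-reduce : ∀ a b → value (reduce a b) ≈ fromℕ a - fromℕ b
    value-reduce zero    b       = refl
    value-reduce (suc a) zero    = refl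
    value-reduce (suc a) (suc b) = begin
      value (reduce a b)                         ≈⟨ value-reduce a b ⟩
      fromℕ a - fromℕ b                          ≈⟨ +-identityˡ _ ⟨
      0# + (fromℕ a - fromℕ b)                   ≈⟨ +-congʳ (-‿inverseʳ 1#) ⟨
      (1# - 1#) + (fromℕ a - fromℕ b)            ≈⟨ solve 4 (λ o o⁻ a b⁻ → ((o ⊕ o⁻) ⊕ (a ⊕ b⁻)) ⊜ ((o ⊕ a) ⊕ (o⁻ ⊕ b⁻))) refl 1# (- 1#) (fromℕ a) (- fromℕ b) ⟩
      (1# + fromℕ a) + (- 1# - fromℕ b)          ≈⟨ +-congˡ (⁻¹-∙-comm 1# (fromℕ b)) ⟩
      fromℕ (suc a) - fromℕ (suc b)              ∎

    +-homo : ∀ x y → value (RawRing._+_ differences x y) ≈ value x + value y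
    +-homo (a , b) (c , d) = trans (trans (value-reduce (a ℕ.+ c) (b ℕ.+ d))
      (+-cong (M.×-homo-+ 1# a c) (-‿cong (M.×-homo-+ 1# b d))))
      (solve 4 (λ a b c d → ((a ⊕ c) ⊕ ⊝ (b ⊕ d)) ⊜ ((a ⊕ ⊝ b) ⊕ (c ⊕ ⊝ d))) refl
        (fromℕ a) (fromℕ b) (fromℕ c) (fromℕ d))

    *-homo : ∀ x y → value (RawRing._*_ differences x y) ≈ value x * value y
    *-homo (a , b) (c , d) = begin
      value (reduce (a ℕ.* c ℕ.+ b ℕ.* d) (a ℕ.* d ℕ.+ b ℕ.* c))
        ≈⟨ value-reduce (a ℕ.* c ℕ.+ b ℕ.* d) (a ℕ.* d ℕ.+ b ℕ.* c) ⟩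
      fromℕ (a ℕ.* c ℕ.+ b ℕ.* d) - fromℕ (a ℕ.* d ℕ.+ b ℕ.* c)
        ≈⟨ +-cong (expand a c b d) (trans (-‿cong (expand a d b c)) (sym (⁻¹-∙-comm _ _))) ⟩
      A * C + B * D + (- (A * D) - B * C)
        ≈⟨ +-cong (+-congˡ (sym -B*-D≈B*D)) (+-cong (-‿distribʳ-* A D) (-‿distribˡ-* B C)) ⟩
      A * C + (- B) * (- D) + (A * (- D) + (- B) * C)
        ≈⟨ solve 4 (λ a b c d → (a ⊗ c ⊕ b ⊗ d ⊕ (a ⊗ d ⊕ b ⊗ c)) ⊜ ((a ⊕ b) ⊗ (c ⊕ d))) refl A (- B) C (- D) ⟩
      (A - B) * (C - D) ∎
      where
      A = fromℕ a
      B = fromℕ b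
      C = fromℕ c
      D = fromℕ d
      expand : ∀ k l m n → fromℕ (k ℕ.* l ℕ.+ m ℕ.* n) ≈ fromℕ k * fromℕ l + fromℕ m * fromℕ n
      expand k l m n = trans (M.×-homo-+ 1# (k ℕ.* l) (m ℕ.* n)) (+-cong (M.×1-homo-* k l) (M.×1-homo-* m n))
      -B*-D≈B*D : (- B) * (- D) ≈ B * D
      -B*-D≈B*D = trans (sym (-‿distribˡ-* B (- D)))
        (trans (-‿cong (sym (-‿distribʳ-* B D))) (⁻¹-involutive (B * D)))

    -‿homo : ∀ x → value (RawRing.-_ differences x) ≈ - value x
    -‿homo (a , b) = sym (⁻¹-anti-homo-// (fromℕ a) (fromℕ b))

    morphism : differences -Raw-AlmostCommutative⟶ fromCommutativeRing commutativeRing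
    morphism = record
      { ⟦_⟧    = value
      ; +-homo = +-homo
      ; *-homo = *-homo
      ; -‿homo = -‿homo
      ; 0-homo = -‿inverseʳ 0#
      ; 1-homo = trans (+-cong (M.×-homo-1 1#) ε⁻¹≈ε) (+-identityʳ 1#)
      }

    equal? : ∀ x y → Maybe (value x ≈ value y)
    equal? (a , b) (c , d) with a ℕₚ.≟ c | b ℕₚ.≟ d
    ... | yes ≡.refl | yes ≡.refl = just refl
    ... | _          | _          = nothing

  open RingSolver Coefficients.differences (fromCommutativeRing commutativeRing)
    Coefficients.morphism Coefficients.equal? public
    using (solve; _:=_; _:+_; _:*_; :-_; _:-_; con)

  open SemiringSum semiring public
    using (sum; sum-cong-≋; sum-remove; ∑-distrib-+; ∑-comm; sum-replicate-zero; *-distribˡ-sum; *-distribʳ-sum)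
  open Algebra.Definitions.RawSemiring (Semiring.rawSemiring semiring) public
    using (product)

  1≉0 : 1# ≉ 0#
  1≉0 = 0≉1 ∘ sym

  x≈y⇒x-y≈0 : ∀ {x y} → x ≈ y → x - y ≈ 0#
  x≈y⇒x-y≈0 {x} {y} eq = trans (+-congʳ eq) (-‿inverseʳ y)

  x*y≈0⇒y≈0 : ∀ {x y} → x ≉ 0# → x * y ≈ 0# → y ≈ 0#
  x*y≈0⇒y≈0 {x} {y} x≉0 xy≈0 with inverse x x≉0
  ... | x⁻¹ , eq = begin
    y               ≈⟨ *-identityˡ y ⟨
    1# * y          ≈⟨ *-congʳ eq ⟨
    x * x⁻¹ * y     ≈⟨ solve 3 (λ x x⁻¹ y → x :* x⁻¹ :* y := x⁻¹ :* (x :* y)) refl x x⁻¹ y ⟩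
    x⁻¹ * (x * y)   ≈⟨ *-congˡ xy≈0 ⟩
    x⁻¹ * 0#        ≈⟨ zeroʳ x⁻¹ ⟩
    0#              ∎

  x*y≉0 : ∀ {x y} → x ≉ 0# → y ≉ 0# → x * y ≉ 0#
  x*y≉0 x≉0 y≉0 = y≉0 ∘ x*y≈0⇒y≈0 x≉0

  *-cancelˡ : ∀ {x y z} → x ≉ 0# → x * y ≈ x * z → y ≈ z
  *-cancelˡ {x} {y} {z} x≉0 eq = x∙y⁻¹≈ε⇒x≈y y z (x*y≈0⇒y≈0 x≉0 (begin
    x * (y - z)     ≈⟨ solve 3 (λ x y z → x :* (y :- z) := x :* y :- x :* z) refl x y z ⟩
    x * y - x * z   ≈⟨ x≈y⇒x-y≈0 eq ⟩
    0#              ∎))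

  x≤y⇒0≤y-x : ∀ {x y} → x ≤ y → 0# ≤ y - x
  x≤y⇒0≤y-x {x} {y} x≤y = ≤-respˡ (-‿inverseˡ x) (≤-respʳ (+-comm (- x) y) (+-monoʳ-≤ (- x) x≤y))

  0≤y-x⇒x≤y : ∀ {x y} → 0# ≤ y - x → x ≤ y
  0≤y-x⇒x≤y {x} {y} 0≤y-x = ≤-respˡ (+-identityʳ x)
    (≤-respʳ (solve 2 (λ x y → x :+ (y :- x) := y) refl x y) (+-monoʳ-≤ x 0≤y-x))

  x≤0⇒0≤-x : ∀ {x} → x ≤ 0# → 0# ≤ - x
  x≤0⇒0≤-x x≤0 = ≤-respʳ (+-identityˡ _) (x≤y⇒0≤y-x x≤0)

  +-mono-≤ : ∀ {w x y z} → w ≤ x → y ≤ z → w + y ≤ x + z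
  +-mono-≤ {w} {x} {y} {z} w≤x y≤z = ≤-trans (+-monoʳ-≤ w y≤z)
    (≤-respˡ (+-comm z w) (≤-respʳ (+-comm z x) (+-monoʳ-≤ z w≤x)))

  +-nonNegative : ∀ {x y} → 0# ≤ x → 0# ≤ y → 0# ≤ x + y
  +-nonNegative 0≤x 0≤y = ≤-respˡ (+-identityˡ 0#) (+-mono-≤ 0≤x 0≤y)

  *-monoˡ-≤ : ∀ {a x y} → 0# ≤ a → x ≤ y → a * x ≤ a * y
  *-monoˡ-≤ {a} {x} {y} 0≤a x≤y = 0≤y-x⇒x≤y
    (≤-respʳ (solve 3 (λ a x y → a :* (y :- x) := a :* y :- a :* x) refl a x y)
      (*-nonNegative 0≤a (x≤y⇒0≤y-x x≤y)))

  0≤x*x : ∀ x → 0# ≤ x * x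
  0≤x*x x with total 0# x
  ... | inj₁ 0≤x = *-nonNegative 0≤x 0≤x
  ... | inj₂ x≤0 = ≤-respʳ (solve 1 (λ x → :- x :* :- x := x :* x) refl x)
    (*-nonNegative (x≤0⇒0≤-x x≤0) (x≤0⇒0≤-x x≤0))

  x*x≈0⇒x≈0 : ∀ {x} → x * x ≈ 0# → x ≈ 0#
  x*x≈0⇒x≈0 {x} eq with x ≟ 0#
  ... | yes x≈0 = x≈0
  ... | no  x≉0 = x*y≈0⇒y≈0 x≉0 eq

  x+y≈0⇒x≈0 : ∀ {x y} → 0# ≤ x → 0# ≤ y → x + y ≈ 0# → x ≈ 0#
  x+y≈0⇒x≈0 {x} {y} 0≤x 0≤y eq = antisym
    (≤-respʳ eq (≤-respˡ (+-identityʳ x) (+-monoʳ-≤ x 0≤y))) 0≤x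

  -- If y ≤ x, then (x - y) + (x - y) is a sum of nonnegative terms that is at most 0, so both terms
  -- vanish.
  double-≤ : ∀ {x y} → x + x ≤ y + y → x ≤ y
  double-≤ {x} {y} xx≤yy with total x y
  ... | inj₁ x≤y = x≤y
  ... | inj₂ y≤x = ≤-reflexive (x∙y⁻¹≈ε⇒x≈y x y (x+y≈0⇒x≈0 (x≤y⇒0≤y-x y≤x) (x≤y⇒0≤y-x y≤x)
    (antisym (≤-respˡ (solve 2 (λ x y → x :+ x :- (y :+ y) := (x :- y) :+ (x :- y)) refl x y)
        (≤-respʳ (-‿inverseʳ (y + y)) (+-mono-≤ xx≤yy (≤-refl { - (y + y)}))))
      (+-nonNegative (x≤y⇒0≤y-x y≤x) (x≤y⇒0≤y-x y≤x)))))

  0≤1 : 0# ≤ 1#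
  0≤1 = ≤-respʳ (*-identityˡ 1#) (0≤x*x 1#)

  0≤fromℕ : ∀ m → 0# ≤ fromℕ m
  0≤fromℕ zero    = ≤-refl
  0≤fromℕ (suc m) = +-nonNegative 0≤1 (0≤fromℕ m)

  fromℕ-homo-+ : ∀ m n → fromℕ (m ℕ.+ n) ≈ fromℕ m + fromℕ n
  fromℕ-homo-+ = M.×-homo-+ 1#

  fromℕ-mono-≤ : ∀ {m n} → m ℕ.≤ n → fromℕ m ≤ fromℕ n
  fromℕ-mono-≤ {n = n} ℕ.z≤n = 0≤fromℕ n
  fromℕ-mono-≤ (ℕ.s≤s m≤n)   = +-monoʳ-≤ 1# (fromℕ-mono-≤ m≤n)

  0<n⇒fromℕ≰0 : ∀ {m} → 0 ℕ.< m → ¬ (fromℕ m ≤ 0#)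
  0<n⇒fromℕ≰0 {suc m} _ le = 1≉0 (x+y≈0⇒x≈0 0≤1 (0≤fromℕ m)
    (antisym le (0≤fromℕ (suc m))))

  sum-cong : ∀ {n} {f g : Fin n → R} → (∀ i → f i ≈ g i) → sum f ≈ sum g
  sum-cong = sum-cong-≋

  sum-zero : ∀ {n} {f : Fin n → R} → (∀ i → f i ≈ 0#) → sum f ≈ 0#
  sum-zero {n} f≈0 = trans (sum-cong f≈0) (sum-replicate-zero n)

  sum-single : ∀ {n} {f : Fin n → R} i → (∀ j → j ≢ i → f j ≈ 0#) → sum f ≈ f i
  sum-single zero    f≈0 = trans (+-congˡ (sum-zero λ j → f≈0 (suc j) λ ())) (+-identityʳ _)
  sum-single (suc i) f≈0 = trans (+-cong (f≈0 zero λ ()) (sum-single i λ j j≢i → f≈0 (suc j) (j≢i ∘ suc-injective)))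
    (+-identityˡ _)

  sum-linear : ∀ {n} a (f g : Fin n → R) → sum (λ i → a * f i + g i) ≈ a * sum f + sum g
  sum-linear a f g = trans (∑-distrib-+ (λ i → a * f i) g) (+-congʳ (sym (*-distribˡ-sum a f)))

  sum-neg : ∀ {n} (f : Fin n → R) → sum (λ i → - f i) ≈ - sum f
  sum-neg f = trans (sum-cong λ i → sym (-1*x≈-x (f i)))
    (trans (sym (*-distribˡ-sum (- 1#) f)) (-1*x≈-x (sum f)))

  sum-mono-≤ : ∀ {n} {f g : Fin n → R} → (∀ i → f i ≤ g i) → sum f ≤ sum g
  sum-mono-≤ {zero}  f≤g = ≤-refl
  sum-mono-≤ {suc n} f≤g = +-mono-≤ (f≤g zero) (sum-mono-≤ (f≤g ∘ suc))

  sum-nonNegative : ∀ {n} {f : Fin n → R} → (∀ i → 0# ≤ f i) → 0# ≤ sum f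
  sum-nonNegative {n} 0≤f = ≤-respˡ (sum-replicate-zero n) (sum-mono-≤ 0≤f)

  sum≈0⇒f≈0 : ∀ {n} {f : Fin n → R} → (∀ i → 0# ≤ f i) → sum f ≈ 0# → ∀ i → f i ≈ 0#
  sum≈0⇒f≈0 0≤f eq zero    = x+y≈0⇒x≈0 (0≤f zero) (sum-nonNegative (0≤f ∘ suc)) eq
  sum≈0⇒f≈0 0≤f eq (suc i) = sum≈0⇒f≈0 (0≤f ∘ suc)
    (x+y≈0⇒x≈0 (sum-nonNegative (0≤f ∘ suc)) (0≤f zero) (trans (+-comm _ _) eq)) i

  product≈0⇒∃≈0 : ∀ {n} {f : Fin n → R} → product f ≈ 0# → ∃ λ i → f i ≈ 0#
  product≈0⇒∃≈0 {zero}  eq = contradiction eq 1≉0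
  product≈0⇒∃≈0 {suc n} {f} eq with f zero ≟ 0#
  ... | yes f₀≈0 = zero , f₀≈0
  ... | no  f₀≉0 with product≈0⇒∃≈0 (x*y≈0⇒y≈0 f₀≉0 eq)
  ...   | i , fᵢ≈0 = suc i , fᵢ≈0

-- Linear algebra: homogeneous systems, kernels and quadratic forms

module LinearAlgebra {c ℓ₁ ℓ₂} (F : OrderedField c ℓ₁ ℓ₂) where

  open FieldProperties F
  open import Relation.Binary.Reasoning.Setoid setoid

  V : ℕ → Set c
  V n = Fin n → R

  infix 4 _≋_
  _≋_ : ∀ {n} → V n → V n → Set ℓ₁
  u ≋ v = ∀ i → u i ≈ v i

  Nonzero : ∀ {n} → V n → Set ℓ₁
  Nonzero v = ∃ λ i → v i ≉ 0#

  -- Both the standard basis and the identity matrix. Recursion on the indices makes its minors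
  -- compute, which `diag` with its decision of equality does not.
  e : ∀ {n} → Fin n → V n
  e zero    zero    = 1#
  e zero    (suc j) = 0#
  e (suc i) zero    = 0#
  e (suc i) (suc j) = e i j

  eᵢᵢ≈1 : ∀ {n} (i : Fin n) → e i i ≈ 1#
  eᵢᵢ≈1 zero    = refl
  eᵢᵢ≈1 (suc i) = eᵢᵢ≈1 i

  eᵢⱼ≈0 : ∀ {n} {i j : Fin n} → i ≢ j → e i j ≈ 0#
  eᵢⱼ≈0 {i = zero}  {zero}  i≢j = contradiction ≡.refl i≢j
  eᵢⱼ≈0 {i = zero}  {suc j} i≢j = refl
  eᵢⱼ≈0 {i = suc i} {zero}  i≢j = refl
  eᵢⱼ≈0 {i = suc i} {suc j} i≢j = eᵢⱼ≈0 (i≢j ∘ ≡.cong suc)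

  e-sym : ∀ {n} (i j : Fin n) → e i j ≈ e j i
  e-sym zero    zero    = refl
  e-sym zero    (suc j) = refl
  e-sym (suc i) zero    = refl
  e-sym (suc i) (suc j) = e-sym i j

  infix 8 _·_
  _·_ : ∀ {n} → V n → V n → R
  u · v = sum λ i → u i * v i

  ·-cong : ∀ {n} {u u′ v v′ : V n} → u ≋ u′ → v ≋ v′ → u · v ≈ u′ · v′
  ·-cong u≋u′ v≋v′ = sum-cong λ i → *-cong (u≋u′ i) (v≋v′ i)

  ·-congˡ : ∀ {n} (u : V n) {v v′ : V n} → v ≋ v′ → u · v ≈ u · v′
  ·-congˡ u = ·-cong (λ _ → refl)

  ·-congʳ : ∀ {n} {u u′ : V n} (v : V n) → u ≋ u′ → u · v ≈ u′ · v
  ·-congʳ v u≋u′ = ·-cong u≋u′ (λ _ → refl)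

  ·-comm : ∀ {n} (u v : V n) → u · v ≈ v · u
  ·-comm u v = sum-cong λ i → *-comm (u i) (v i)

  ·-linear : ∀ {n} (u : V n) a (v w : V n) → u · (λ i → a * v i + w i) ≈ a * u · v + u · w
  ·-linear u a v w = trans
    (sum-cong λ i → solve 4 (λ u a v w → u :* (a :* v :+ w) := a :* (u :* v) :+ u :* w) refl (u i) a (v i) (w i))
    (sum-linear a (λ i → u i * v i) (λ i → u i * w i))

  ·-zeroʳ : ∀ {n} (u : V n) {v} → (∀ i → v i ≈ 0#) → u · v ≈ 0#
  ·-zeroʳ u v≈0 = sum-zero λ i → trans (*-congˡ (v≈0 i)) (zeroʳ _)

  ·-scale : ∀ {n} (u : V n) a (v : V n) → u · (λ i → a * v i) ≈ a * u · v
  ·-scale u a v = trans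
    (·-cong (λ _ → refl) (λ i → sym (+-identityʳ (a * v i))))
    (trans (·-linear u a v (λ _ → 0#)) (trans (+-congˡ (·-zeroʳ u λ _ → refl)) (+-identityʳ _)))

  ·-pencil : ∀ {n} (u : V n) x (v w : V n) → u · (λ i → x * v i - w i) ≈ x * u · v - u · w
  ·-pencil u x v w = trans (·-linear u x v (λ i → - w i)) (+-congˡ
    (trans (sum-cong λ i → sym (-‿distribʳ-* (u i) (w i))) (sum-neg (λ i → u i * w i))))

  pencil-· : ∀ {n} x (v w u : V n) → (λ i → x * v i - w i) · u ≈ x * v · u - w · u
  pencil-· x v w u = trans (·-comm _ u) (trans (·-pencil u x v w)
    (+-cong (*-congˡ (·-comm u v)) (-‿cong (·-comm u w))))

  e· : ∀ {n} (i : Fin n) (v : V n) → e i · v ≈ v i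
  e· i v = trans (sum-single i λ j j≢i → trans (*-congʳ (eᵢⱼ≈0 (j≢i ∘ ≡.sym))) (zeroˡ _))
    (trans (*-congʳ (eᵢᵢ≈1 i)) (*-identityˡ _))

  ·e : ∀ {n} (v : V n) (i : Fin n) → v · e i ≈ v i
  ·e v i = trans (·-comm v (e i)) (e· i v)

  infixr 8 _⊙_
  _⊙_ : ∀ {m n} → (Fin m → V n) → V n → V m
  (N ⊙ v) i = N i · v

  ⊙-adjoint : ∀ {m n} (N : Fin m → V n) (v : V n) (u : V m) → (N ⊙ v) · u ≈ v · (flip N ⊙ u)
  ⊙-adjoint N v u = begin
    sum (λ i → sum (λ j → N i j * v j) * u i)     ≈⟨ sum-cong (λ i → *-distribʳ-sum (u i) (λ j → N i j * v j)) ⟩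
    sum (λ i → sum (λ j → N i j * v j * u i))     ≈⟨ ∑-comm (λ i j → N i j * v j * u i) ⟩
    sum (λ j → sum (λ i → N i j * v j * u i))     ≈⟨ sum-cong (λ j → sum-cong λ i →
      solve 3 (λ n v u → n :* v :* u := v :* (n :* u)) refl (N i j) (v j) (u i)) ⟩
    sum (λ j → sum (λ i → v j * (N i j * u i)))   ≈⟨ sum-cong (λ j → *-distribˡ-sum (v j) (λ i → N i j * u i)) ⟨
    v · (flip N ⊙ u)                              ∎

  ⊙-assoc : ∀ {l m n} (M : Fin l → V m) (C : Fin n → V m) (v : V n) →
            M ⊙ (flip C ⊙ v) ≋ (λ i j → M i · C j) ⊙ v
  ⊙-assoc M C v i = begin
    M i · (flip C ⊙ v)         ≈⟨ ·-comm (M i) (flip C ⊙ v) ⟩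
    (flip C ⊙ v) · M i         ≈⟨ ⊙-adjoint (flip C) v (M i) ⟩
    v · (C ⊙ M i)              ≈⟨ ·-comm v (C ⊙ M i) ⟩
    (C ⊙ M i) · v              ≈⟨ ·-cong (λ j → ·-comm (C j) (M i)) (λ _ → refl) ⟩
    (λ j → M i · C j) · v      ∎

  -- Deleting coordinate `j` from every equation gives a system in one unknown less, whose solution
  -- is extended by 0 at `j`. The parameter `solution` stands for the recursive call of the lemma of
  -- that name.
  solution-through : ∀ {n} → (∀ (rows : List (V n)) → length rows ℕ.< n → ∃ λ x → Nonzero x × All (λ r → r · x ≈ 0#) rows) →
                     (j : Fin (suc n)) (rows : List (V (suc n))) → length rows ℕ.< n →
                     ∃ λ x → Nonzero x × (x j ≈ 0#) × All (λ r → r · x ≈ 0#) rows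
  solution-through solution j rows len
    with solution (List.map (_∘ punchIn j) rows) (≡.subst (ℕ._< _) (≡.sym (Listₚ.length-map _ rows)) len)
  ... | x , (i , xᵢ≉0) , sol =
    insertAt x j 0# ,
    (punchIn j i , xᵢ≉0 ∘ trans (reflexive (≡.sym (Vectorₚ.insertAt-punchIn x j 0# i)))) ,
    reflexive (Vectorₚ.insertAt-lookup x j 0#) ,
    All.map (λ {r} → lift r) (Allₚ.map⁻ sol)
    where
    lift : ∀ r → (r ∘ punchIn j) · x ≈ 0# → r · insertAt x j 0# ≈ 0#
    lift r eq = begin
      r · insertAt x j 0#
        ≈⟨ sum-remove {i = j} (λ i → r i * insertAt x j 0# i) ⟩
      r j * insertAt x j 0# j + sum (λ i → r (punchIn j i) * insertAt x j 0# (punchIn j i))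
        ≈⟨ +-cong (trans (*-congˡ (reflexive (Vectorₚ.insertAt-lookup x j 0#))) (zeroʳ _))
                  (sum-cong λ i → *-congˡ (reflexive (Vectorₚ.insertAt-punchIn x j 0# i))) ⟩
      0# + (r ∘ punchIn j) · x
        ≈⟨ trans (+-identityˡ _) eq ⟩
      0# ∎

  -- Two solutions of the remaining equations, of which the second vanishes at a
  -- coordinate where the first does not, combine to a solution of the first equation too.
  solution : ∀ {n} (rows : List (V n)) → length rows ℕ.< n →
             ∃ λ x → Nonzero x × All (λ r → r · x ≈ 0#) rows
  solution {suc n} []         _         = (λ _ → 1#) , (zero , 1≉0) , []
  solution {suc n} (r ∷ rows) (s≤s len) with solution-through solution zero rows len
  ... | y , (j , yⱼ≉0) , _ , sol-y with solution-through solution j rows len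
  ...   | z , z≠0 , zⱼ≈0 , sol-z with r · z ≟ 0#
  ...     | yes rz≈0 = z , z≠0 , rz≈0 ∷ sol-z
  ...     | no  rz≉0 = x , (j , xⱼ≉0) , rx≈0 ∷ All.map (λ {r′} (p , q) → lift r′ p q) (All.zip (sol-y , sol-z))
    where
    x : V (suc n)
    x i = r · z * y i + - (r · y) * z i
    expand : ∀ r′ → r′ · x ≈ r · z * r′ · y + - (r · y) * r′ · z
    expand r′ = trans (·-linear r′ (r · z) y (λ i → - (r · y) * z i)) (+-congˡ (·-scale r′ (- (r · y)) z))
    rx≈0 : r · x ≈ 0#
    rx≈0 = trans (expand r) (trans
      (solve 2 (λ z y → z :* y :+ (:- y) :* z := y :* z :- y :* z) refl (r · z) (r · y)) (-‿inverseʳ _))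
    lift : ∀ r′ → r′ · y ≈ 0# → r′ · z ≈ 0# → r′ · x ≈ 0#
    lift r′ p q = trans (expand r′) (trans (+-cong (trans (*-congˡ p) (zeroʳ _)) (trans (*-congˡ q) (zeroʳ _))) (+-identityʳ _))
    xⱼ≉0 : x j ≉ 0#
    xⱼ≉0 eq = x*y≉0 rz≉0 yⱼ≉0 (trans
      (sym (trans (+-congˡ (trans (*-congˡ zⱼ≈0) (zeroʳ _))) (+-identityʳ _))) eq)

  Kernel : ∀ {n} → (Fin n → V n) → V n → Set _
  Kernel N v = Nonzero v × (∀ i → (N ⊙ v) i ≈ 0#)

  -- The n equations x₀ b + N x = 0 in n + 1 unknowns have a nonzero solution. If x₀ = 0, then x is
  -- in the kernel; otherwise - x / x₀ is a preimage of `b`.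
  kernel-or-preimage : ∀ {n} (N : Fin n → V n) (b : V n) → ∃ (Kernel N) ⊎ ∃ λ x → N ⊙ x ≋ b
  kernel-or-preimage {n} N b
    with solution (List.tabulate λ i → b i Vector.∷ N i) (ℕₚ.≤-reflexive (≡.cong suc (Listₚ.length-tabulate (λ i → b i Vector.∷ N i))))
  ... | x , (k , xₖ≉0) , sol with x zero ≟ 0#
  ...   | yes x₀≈0 = inj₁ (x ∘ suc , nonzero k xₖ≉0 , λ i → begin
    N i · (x ∘ suc)                  ≈⟨ +-identityˡ _ ⟨
    0# + N i · (x ∘ suc)             ≈⟨ +-congʳ (trans (*-congˡ x₀≈0) (zeroʳ (b i))) ⟨
    (b i Vector.∷ N i) · x           ≈⟨ Allₚ.tabulate⁻ sol i ⟩
    0#                               ∎)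
    where
    nonzero : ∀ k → x k ≉ 0# → Nonzero (x ∘ suc)
    nonzero zero    x₀≉0 = contradiction x₀≈0 x₀≉0
    nonzero (suc k) xₖ≉0 = k , xₖ≉0
  ...   | no x₀≉0 with inverse (x zero) x₀≉0
  ...     | t , x₀t≈1 = inj₂ ((λ j → - t * x (suc j)) , λ i → begin
    N i · (λ j → - t * x (suc j))    ≈⟨ ·-scale (N i) (- t) (x ∘ suc) ⟩
    - t * N i · (x ∘ suc)            ≈⟨ solve 4 (λ t s b y → (:- t) :* s := b :* (y :* t) :- t :* (b :* y :+ s)) refl
                                          t (N i · (x ∘ suc)) (b i) (x zero) ⟩
    b i * (x zero * t) - t * ((b i Vector.∷ N i) · x)
                                     ≈⟨ +-cong (trans (*-congˡ x₀t≈1) (*-identityʳ (b i)))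
                                          (-‿cong (trans (*-congˡ (Allₚ.tabulate⁻ sol i)) (zeroʳ t))) ⟩
    b i - 0#                         ≈⟨ trans (+-congˡ ε⁻¹≈ε) (+-identityʳ (b i)) ⟩
    b i                              ∎)

  choose : ∀ {n a b} {A : Set a} {B : Fin n → Set b} → (∀ j → A ⊎ B j) → A ⊎ (∀ j → B j)
  choose {zero}  f = inj₂ λ ()
  choose {suc n} f with f zero | choose (f ∘ suc)
  ... | inj₁ a | _      = inj₁ a
  ... | inj₂ b | inj₁ a = inj₁ a
  ... | inj₂ b | inj₂ g = inj₂ λ { zero → b ; (suc j) → g j }

  RightInverse : ∀ {n} → (Fin n → V n) → (Fin n → V n) → Set ℓ₁
  RightInverse N Q = ∀ j → N ⊙ flip Q j ≋ e j

  kernel-or-inverse : ∀ {n} (N : Fin n → V n) → ∃ (Kernel N) ⊎ ∃ (RightInverse N)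
  kernel-or-inverse N with choose (λ j → kernel-or-preimage N (e j))
  ... | inj₁ k = inj₁ k
  ... | inj₂ q = inj₂ ((λ i j → proj₁ (q j) i) , λ j → proj₂ (q j))

  quad : ∀ {n} → (Fin n → V n) → V n → R
  quad M x = x · (M ⊙ x)

  -- The matrix C M Cᵀ: the form `M` in the coordinates given by the family of vectors `C`.
  gram : ∀ {m n} → (Fin n → V n) → (Fin m → V n) → Fin m → V m
  gram M C i j = C i · (M ⊙ C j)

  quad-gram : ∀ {m n} (M : Fin n → V n) (C : Fin m → V n) (y : V m) →
              quad M (flip C ⊙ y) ≈ quad (gram M C) y
  quad-gram M C y = begin
    (flip C ⊙ y) · (M ⊙ (flip C ⊙ y))           ≈⟨ ⊙-adjoint (flip C) y _ ⟩
    y · (C ⊙ (M ⊙ (flip C ⊙ y)))                ≈⟨ ·-congˡ y (λ i → ·-congˡ (C i) (⊙-assoc M C y)) ⟩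
    y · (C ⊙ ((λ k j → M k · C j) ⊙ y))         ≈⟨ ·-congˡ y (⊙-assoc C (λ j k → M k · C j) y) ⟩
    quad (gram M C) y                           ∎

  quad-cong : ∀ {n} (M : Fin n → V n) {x y : V n} → x ≋ y → quad M x ≈ quad M y
  quad-cong M x≋y = ·-cong x≋y λ i → ·-congˡ (M i) x≋y

  SymmetricM : ∀ {n} → (Fin n → V n) → Set ℓ₁
  SymmetricM M = ∀ i j → M i j ≈ M j i

  symmetric-· : ∀ {n} {M : Fin n → V n} → SymmetricM M → ∀ u v → u · (M ⊙ v) ≈ (M ⊙ u) · v
  symmetric-· {M = M} M-sym u v = begin
    u · (M ⊙ v)          ≈⟨ ·-congˡ u (λ i → ·-congʳ v (M-sym i)) ⟩
    u · (flip M ⊙ v)     ≈⟨ ⊙-adjoint M u v ⟨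
    (M ⊙ u) · v          ∎

  gram-symmetric : ∀ {m n} {M : Fin n → V n} → SymmetricM M → (C : Fin m → V n) → SymmetricM (gram M C)
  gram-symmetric M-sym C i j = trans (symmetric-· M-sym (C i) (C j)) (·-comm _ (C j))

-- Determinants: alternating forms and multiplicativity

-- Alternation is required for neighbouring arguments only: in a Laplace expansion the two terms
-- that delete one of two equal neighbouring columns then have the same minor and opposite signs.
data Next : ∀ {n} → Fin n → Fin n → Set where
  here  : ∀ {n} → Next {suc (suc n)} zero (suc zero)
  there : ∀ {n} {i j : Fin n} → Next i j → Next (suc i) (suc j)

next-inject₁ : ∀ {n} (k : Fin n) → Next (inject₁ k) (suc k)
next-inject₁ zero    = here
next-inject₁ (suc k) = there (next-inject₁ k)

next⇒≢ : ∀ {n} {i j : Fin n} → Next i j → i ≢ j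
next⇒≢ (there ij) eq = next⇒≢ ij (suc-injective eq)

next-toℕ : ∀ {n} {i j : Fin n} → Next i j → toℕ j ≡ suc (toℕ i)
next-toℕ here       = ≡.refl
next-toℕ (there ij) = ≡.cong suc (next-toℕ ij)

-- A minor that deletes some third column still contains the two columns as neighbours, so induction
-- applies to it.
next-punchIn : ∀ {n} {i j : Fin (suc n)} (l : Fin (suc n)) → Next i j → l ≢ i → l ≢ j →
               ∃₂ λ i′ j′ → Next i′ j′ × punchIn l i′ ≡ i × punchIn l j′ ≡ j
next-punchIn zero                here                l≢i l≢j = contradiction ≡.refl l≢i
next-punchIn zero                (there ij)          l≢i l≢j = _ , _ , ij , ≡.refl , ≡.refl
next-punchIn (suc zero)          here                l≢i l≢j = contradiction ≡.refl l≢j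
next-punchIn {suc (suc n)} (suc (suc l)) here        l≢i l≢j = zero , suc zero , here , ≡.refl , ≡.refl
next-punchIn {suc n} (suc l)     (there ij)          l≢i l≢j
  with next-punchIn l ij (l≢i ∘ ≡.cong suc) (l≢j ∘ ≡.cong suc)
... | i′ , j′ , ij′ , p , q = suc i′ , suc j′ , there ij′ , ≡.cong suc p , ≡.cong suc q

module Determinant {c ℓ₁ ℓ₂} (F : OrderedField c ℓ₁ ℓ₂) where

  open FieldProperties F
  open LinearAlgebra F
  open Spectra F using (det)
  open Algebra.Definitions.RawSemiring (Semiring.rawSemiring semiring) using (_^_)
  open import Relation.Binary.Reasoning.Setoid setoid

  -- The determinant as a function of the tuple of columns. Since `det` expands along the first row,
  -- each term takes one entry and a minor from these columns.
  detᶜ : ∀ {n} → (Fin n → V n) → R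
  detᶜ X = det (flip X)

  private
    minor : ∀ {n} → (Fin (suc n) → V (suc n)) → Fin (suc n) → Fin n → V n
    minor X j s r = X (punchIn j s) (suc r)

    term : ∀ {n} → (Fin (suc n) → V (suc n)) → Fin (suc n) → R
    term X j = (- 1#) ^ toℕ j * X j zero * detᶜ (minor X j)

  det-cong : ∀ {n} {A B : Fin n → V n} → (∀ i j → A i j ≈ B i j) → det A ≈ det B
  det-cong {zero}  A≈B = refl
  det-cong {suc n} A≈B = sum-cong λ j →
    *-cong (*-congˡ {(- 1#) ^ toℕ j} (A≈B zero j)) (det-cong λ r s → A≈B (suc r) (punchIn j s))

  det-first-row : ∀ {n} (A : Fin (suc n) → V (suc n)) → (∀ j → A zero (suc j) ≈ 0#) →
                  det A ≈ A zero zero * det (λ i j → A (suc i) (suc j))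
  det-first-row A eq = trans
    (sum-single {f = term (flip A)} zero λ { zero 0≢0 → contradiction ≡.refl 0≢0
                       ; (suc j) _ → trans (*-congʳ (trans (*-congˡ (eq j)) (zeroʳ _))) (zeroˡ _) })
    (*-congʳ {det λ i j → A (suc i) (suc j)} (*-identityˡ (A zero zero)))

  det-e : ∀ {n} → det (e {n}) ≈ 1#
  det-e {zero}  = refl
  det-e {suc n} = trans (det-first-row (e {suc n}) (λ _ → refl)) (trans (*-identityˡ _) (det-e {n}))

  -- Linearity compares three tuples that agree off `j`, so that replacing an entry of a tuple need
  -- not be an operation; the form a Y + Z covers sums and multiples at once.
  record Alternating {m n} (Φ : (Fin n → V m) → R) : Set (c Level.⊔ ℓ₁) where
    field
      cong        : ∀ {X Y} → (∀ j → X j ≋ Y j) → Φ X ≈ Φ Y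
      linear      : ∀ j a X Y Z → (∀ k → k ≢ j → X k ≋ Y k) → (∀ k → k ≢ j → X k ≋ Z k) →
                    X j ≋ (λ i → a * Y j i + Z j i) → Φ X ≈ a * Φ Y + Φ Z
      alternating : ∀ {i j} → Next i j → ∀ X → X i ≋ X j → Φ X ≈ 0#

  private
    sum-next : ∀ {n} {i j : Fin n} (f : Fin n → R) → Next i j →
               (∀ l → l ≢ i → l ≢ j → f l ≈ 0#) → f i + f j ≈ 0# → sum f ≈ 0#
    sum-next f here f≈0 eq = trans (sym (+-assoc _ _ _))
      (trans (+-cong eq (sum-zero λ l → f≈0 (suc (suc l)) (λ ()) (λ ()))) (+-identityˡ _))
    sum-next f (there ij) f≈0 eq = trans
      (+-cong (f≈0 zero (λ ()) (λ ()))
        (sum-next (f ∘ suc) ij (λ l l≢i l≢j → f≈0 (suc l) (l≢i ∘ suc-injective) (l≢j ∘ suc-injective)) eq))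
      (+-identityˡ _)

    punchIn-next : ∀ {n m} {i j : Fin (suc n)} → Next i j → (X : Fin (suc n) → V m) → X i ≋ X j →
                   ∀ s → X (punchIn i s) ≋ X (punchIn j s)
    punchIn-next here       X eq zero    = λ r → sym (eq r)
    punchIn-next here       X eq (suc s) = λ r → refl
    punchIn-next (there ij) X eq zero    = λ r → refl
    punchIn-next (there ij) X eq (suc s) = punchIn-next ij (X ∘ suc) eq s

  -- In the term of column `j` the entry is linear and the minor does not contain that column; in
  -- every other term the entry is fixed and the minor is linear by induction.
  detᶜ-linear : ∀ {n} j a (X Y Z : Fin n → V n) → (∀ k → k ≢ j → X k ≋ Y k) → (∀ k → k ≢ j → X k ≋ Z k) →
                X j ≋ (λ i → a * Y j i + Z j i) → detᶜ X ≈ a * detᶜ Y + detᶜ Z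
  detᶜ-linear {suc n} j a X Y Z X≋Y X≋Z eq = trans (sum-cong linear-term) (sum-linear a (term Y) (term Z))
    where
    linear-term : ∀ l → term X l ≈ a * term Y l + term Z l
    linear-term l with l ≟ᶠ j
    ... | yes ≡.refl = begin
      (- 1#) ^ toℕ l * X l zero * detᶜ (minor X l)
        ≈⟨ *-congʳ (*-congˡ (eq zero)) ⟩
      (- 1#) ^ toℕ l * (a * Y l zero + Z l zero) * detᶜ (minor X l)
        ≈⟨ solve 5 (λ s a y z d → s :* (a :* y :+ z) :* d := a :* (s :* y :* d) :+ s :* z :* d) refl
             ((- 1#) ^ toℕ l) a (Y l zero) (Z l zero) (detᶜ (minor X l)) ⟩
      a * ((- 1#) ^ toℕ l * Y l zero * detᶜ (minor X l)) + (- 1#) ^ toℕ l * Z l zero * detᶜ (minor X l)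
        ≈⟨ +-cong (*-congˡ (*-congˡ (det-cong λ r s → X≋Y (punchIn l s) (punchInᵢ≢i l s) (suc r))))
                  (*-congˡ (det-cong λ r s → X≋Z (punchIn l s) (punchInᵢ≢i l s) (suc r))) ⟩
      a * term Y l + term Z l ∎
    ... | no l≢j = begin
      (- 1#) ^ toℕ l * X l zero * detᶜ (minor X l)
        ≈⟨ *-congˡ (detᶜ-linear j′ a (minor X l) (minor Y l) (minor Z l)
             (λ k k≢j′ → X≋Y (punchIn l k) (k≢j′ ∘ injective) ∘ suc)
             (λ k k≢j′ → X≋Z (punchIn l k) (k≢j′ ∘ injective) ∘ suc)
             (λ i → ≡.subst (λ k → X k (suc i) ≈ a * Y k (suc i) + Z k (suc i)) (≡.sym (punchIn-punchOut l≢j)) (eq (suc i)))) ⟩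
      (- 1#) ^ toℕ l * X l zero * (a * detᶜ (minor Y l) + detᶜ (minor Z l))
        ≈⟨ solve 5 (λ s x a y z → s :* x :* (a :* y :+ z) := a :* (s :* x :* y) :+ s :* x :* z) refl
             ((- 1#) ^ toℕ l) (X l zero) a (detᶜ (minor Y l)) (detᶜ (minor Z l)) ⟩
      a * ((- 1#) ^ toℕ l * X l zero * detᶜ (minor Y l)) + (- 1#) ^ toℕ l * X l zero * detᶜ (minor Z l)
        ≈⟨ +-cong (*-congˡ (*-congʳ (*-congˡ (X≋Y l l≢j zero)))) (*-congʳ (*-congˡ (X≋Z l l≢j zero))) ⟩
      a * term Y l + term Z l ∎
      where
      j′ = punchOut l≢j
      injective : ∀ {k} → punchIn l k ≡ j → k ≡ j′
      injective {k} p = punchIn-injective l k j′ (≡.trans p (≡.sym (punchIn-punchOut l≢j)))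

  -- A minor that keeps both equal columns vanishes by induction. The two remaining terms have equal
  -- entries, equal minors and opposite signs.
  detᶜ-alternating : ∀ {n} {i j : Fin n} → Next i j → ∀ X → X i ≋ X j → detᶜ X ≈ 0#
  detᶜ-alternating {suc n} {i} {j} ij X eq = sum-next (term X) ij others
    (begin
      term X i + (- 1#) ^ toℕ j * X j zero * detᶜ (minor X j)
        ≈⟨ +-congˡ (*-cong (*-cong (reflexive (≡.cong ((- 1#) ^_) (next-toℕ ij))) (sym (eq zero)))
             (det-cong λ r s → sym (punchIn-next ij X eq s (suc r)))) ⟩
      term X i + (- 1# * (- 1#) ^ toℕ i) * X i zero * detᶜ (minor X i)
        ≈⟨ solve 4 (λ o s x d → s :* x :* d :+ (:- o :* s) :* x :* d := (s :* x :* d) :- o :* (s :* x :* d)) refl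
             1# ((- 1#) ^ toℕ i) (X i zero) (detᶜ (minor X i)) ⟩
      term X i - 1# * term X i
        ≈⟨ trans (+-congˡ (-‿cong (*-identityˡ _))) (-‿inverseʳ _) ⟩
      0# ∎)
    where
    others : ∀ l → l ≢ i → l ≢ j → term X l ≈ 0#
    others l l≢i l≢j with next-punchIn l ij l≢i l≢j
    ... | i′ , j′ , ij′ , p , q = trans
      (*-congˡ (detᶜ-alternating ij′ (minor X l) λ r →
        trans (reflexive (≡.cong (λ k → X k (suc r)) p)) (trans (eq (suc r)) (reflexive (≡.cong (λ k → X k (suc r)) (≡.sym q))))))
      (zeroʳ _)

  -- The restriction of an alternating form to tuples of basis vectors, as a function of their indices.
  record AlternatingSymbol {m n} (ε : (Fin n → Fin m) → R) : Set ℓ₁ where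
    field
      cong   : ∀ {f g} → f ≗ g → ε f ≈ ε g
      repeat : ∀ {i j} → Next i j → ∀ f → f i ≡ f j → ε f ≈ 0#
      swap   : ∀ {i j} → Next i j → ∀ f g → f i ≡ g j → f j ≡ g i →
               (∀ k → k ≢ i → k ≢ j → f k ≡ g k) → ε g ≈ 0# → ε f ≈ 0#

  private
    insertAt-suc : ∀ {a} {A : Set a} {n} (g : Fin n → A) k v → insertAt g (suc k) v (inject₁ k) ≡ g k
    insertAt-suc g zero    v = ≡.refl
    insertAt-suc g (suc k) v = insertAt-suc (g ∘ suc) k v

    insertAt-inject₁ : ∀ {a} {A : Set a} {n} (g : Fin n → A) k v → insertAt g (inject₁ k) v (suc k) ≡ g k
    insertAt-inject₁ g zero    v = ≡.refl
    insertAt-inject₁ g (suc k) v = insertAt-inject₁ (g ∘ suc) k v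

    insertAt-other : ∀ {a} {A : Set a} {n} (g : Fin n → A) k v l → l ≢ inject₁ k → l ≢ suc k →
                     insertAt g (inject₁ k) v l ≡ insertAt g (suc k) v l
    insertAt-other g zero    v zero          l≢0 l≢1 = contradiction ≡.refl l≢0
    insertAt-other g zero    v (suc zero)    l≢0 l≢1 = contradiction ≡.refl l≢1
    insertAt-other g zero    v (suc (suc l)) l≢k l≢k+1 = ≡.refl
    insertAt-other g (suc k) v zero          l≢k l≢k+1 = ≡.refl
    insertAt-other g (suc k) v (suc l)       l≢k l≢k+1 =
      insertAt-other (g ∘ suc) k v l (l≢k ∘ ≡.cong suc) (l≢k+1 ∘ ≡.cong suc)

  -- The value `v` travels to the front by swaps of neighbours. Each swap preserves vanishing, so no
  -- sign is counted.
  symbol-move : ∀ {m n} {ε : (Fin (suc n) → Fin m) → R} → AlternatingSymbol ε →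
                ∀ g v k → ε (insertAt g k v) ≈ 0# → ε (v Vector.∷ g) ≈ 0#
  symbol-move {ε = ε} sym-ε g v = <-weakInduction (λ k → ε (insertAt g k v) ≈ 0# → ε (v Vector.∷ g) ≈ 0#)
    (trans (cong λ { zero → ≡.refl ; (suc j) → ≡.refl }))
    (λ k step eq → step (swap (next-inject₁ k) (insertAt g (inject₁ k) v) (insertAt g (suc k) v)
      (≡.trans (Vectorₚ.insertAt-lookup g (inject₁ k) v) (≡.sym (Vectorₚ.insertAt-lookup g (suc k) v)))
      (≡.trans (insertAt-inject₁ g k v) (≡.sym (insertAt-suc g k v)))
      (insertAt-other g k v) eq))
    where open AlternatingSymbol sym-ε

  -- Either the first value occurs again, and can be moved next to its repetition, or the
  -- other values form a map on one point less; the identity on these is a cyclic shift.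
  symbol-unique : ∀ {n} {ε : (Fin n → Fin n) → R} → AlternatingSymbol ε → ε id ≈ 0# → ∀ f → ε f ≈ 0#
  symbol-unique {zero}  ε-alt ε-id f = trans (AlternatingSymbol.cong ε-alt λ ()) ε-id
  symbol-unique {suc n} {ε} ε-alt ε-id f with any? (λ s → f (suc s) ≟ᶠ f zero)
  ... | yes (s , fs≡f0) = trans (cong λ { zero → ≡.refl ; (suc j) → ≡.refl })
    (symbol-move ε-alt (f ∘ suc) (f zero) (inject₁ s)
      (repeat (next-inject₁ s) (insertAt (f ∘ suc) (inject₁ s) (f zero))
        (≡.trans (Vectorₚ.insertAt-lookup (f ∘ suc) (inject₁ s) (f zero))
          (≡.trans (≡.sym fs≡f0) (≡.sym (insertAt-inject₁ (f ∘ suc) s (f zero)))))))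
    where open AlternatingSymbol ε-alt
  ... | no ∄s = trans
    (cong λ { zero → ≡.refl ; (suc s) → ≡.sym (punchIn-punchOut (∄s ∘ (s ,_) ∘ ≡.sym)) })
    (symbol-unique rest-alt rest-id λ s → punchOut (∄s ∘ (s ,_) ∘ ≡.sym))
    where
    open AlternatingSymbol ε-alt
    i = f zero
    rest : (Fin n → Fin n) → R
    rest g = ε (i Vector.∷ punchIn i ∘ g)
    rest-alt : AlternatingSymbol rest
    rest-alt = record
      { cong   = λ f≗g → cong λ { zero → ≡.refl ; (suc s) → ≡.cong (punchIn i) (f≗g s) }
      ; repeat = λ ij g eq → repeat (there ij) _ (≡.cong (punchIn i) eq)
      ; swap   = λ ij g h p q r → swap (there ij) _ _ (≡.cong (punchIn i) p) (≡.cong (punchIn i) q)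
          λ { zero _ _ → ≡.refl ; (suc k) k≢i k≢j → ≡.cong (punchIn i) (r k (k≢i ∘ ≡.cong suc) (k≢j ∘ ≡.cong suc)) }
      }
    insertAt-id : insertAt (punchIn i) i i ≗ id
    insertAt-id k with i ≟ᶠ k
    ... | yes ≡.refl = Vectorₚ.insertAt-lookup (punchIn i) i i
    ... | no  i≢k    = ≡.subst (λ k → insertAt (punchIn i) i i k ≡ k) (punchIn-punchOut i≢k)
      (Vectorₚ.insertAt-punchIn (punchIn i) i i (punchOut i≢k))
    rest-id : rest id ≈ 0#
    rest-id = symbol-move ε-alt (punchIn i) i i (trans (cong insertAt-id) ε-id)

  module _ {m n} {Φ : (Fin n → V m) → R} (Φ-alt : Alternating Φ) where
    open Alternating Φ-alt

    -- Polarisation: with u + v in both places the form vanishes, and so it does with u or v in both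
    -- places; the expansion leaves the two mixed terms.
    alternating-swap : ∀ {i j} → Next i j → ∀ X Y → X i ≋ Y j → X j ≋ Y i →
                       (∀ k → k ≢ i → k ≢ j → X k ≋ Y k) → Φ X + Φ Y ≈ 0#
    alternating-swap {i} {j} ij X Y XᵢYⱼ XⱼYᵢ rest = begin
      Φ X + Φ Y
        ≈⟨ +-cong (cong λ k r → reflexive (≡.sym (Z-X k r))) (cong λ k r → sym (Z-Y k r)) ⟩
      Φ (Z u v) + Φ (Z v u)
        ≈⟨ +-cong (+-identityˡ _) (+-identityʳ _) ⟨
      (0# + Φ (Z u v)) + (Φ (Z v u) + 0#)
        ≈⟨ +-cong (+-congʳ (Zww≈0 u)) (+-congˡ (Zww≈0 v)) ⟨
      (Φ (Z u u) + Φ (Z u v)) + (Φ (Z v u) + Φ (Z v v))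
        ≈⟨ +-cong (splitʳ u) (splitʳ v) ⟨
      Φ (Z u w) + Φ (Z v w)
        ≈⟨ splitˡ ⟨
      Φ (Z w w)
        ≈⟨ Zww≈0 w ⟩
      0# ∎
      where
      u = X i
      v = X j
      -- The factor `1#` gives the sum u + v the shape that `linear` asks for.
      w : V m
      w r = 1# * u r + v r
      Z : V m → V m → Fin n → V m
      Z x y k with k ≟ᶠ i | k ≟ᶠ j
      ... | yes _ | _     = x
      ... | no _  | yes _ = y
      ... | no _  | no _  = X k
      Zᵢ : ∀ x y → Z x y i ≡ x
      Zᵢ x y with i ≟ᶠ i | i ≟ᶠ j
      ... | yes _  | _ = ≡.refl
      ... | no i≢i | _ = contradiction ≡.refl i≢i
      Zⱼ : ∀ x y → Z x y j ≡ y
      Zⱼ x y with j ≟ᶠ i | j ≟ᶠ j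
      ... | yes j≡i | _      = contradiction (≡.sym j≡i) (next⇒≢ ij)
      ... | no _    | yes _  = ≡.refl
      ... | no _    | no j≢j = contradiction ≡.refl j≢j
      Z-i : ∀ x x′ y k → k ≢ i → Z x y k ≡ Z x′ y k
      Z-i x x′ y k k≢i with k ≟ᶠ i | k ≟ᶠ j
      ... | yes k≡i | _     = contradiction k≡i k≢i
      ... | no _    | yes _ = ≡.refl
      ... | no _    | no _  = ≡.refl
      Z-j : ∀ x y y′ k → k ≢ j → Z x y k ≡ Z x y′ k
      Z-j x y y′ k k≢j with k ≟ᶠ i | k ≟ᶠ j
      ... | yes _ | _       = ≡.refl
      ... | no _  | yes k≡j = contradiction k≡j k≢j
      ... | no _  | no _    = ≡.refl
      Z-X : ∀ k r → Z u v k r ≡ X k r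
      Z-X k r with k ≟ᶠ i | k ≟ᶠ j
      ... | yes ≡.refl | _          = ≡.refl
      ... | no _       | yes ≡.refl = ≡.refl
      ... | no _       | no _       = ≡.refl
      Z-Y : ∀ k → Z v u k ≋ Y k
      Z-Y k r with k ≟ᶠ i | k ≟ᶠ j
      ... | yes ≡.refl | _          = XⱼYᵢ r
      ... | no _       | yes ≡.refl = XᵢYⱼ r
      ... | no k≢i     | no k≢j     = rest k k≢i k≢j r
      at : ∀ {x y : V m} → x ≡ y → x ≋ y
      at ≡.refl r = refl
      Zww≈0 : ∀ x → Φ (Z x x) ≈ 0#
      Zww≈0 x = alternating ij (Z x x) (at (≡.trans (Zᵢ x x) (≡.sym (Zⱼ x x))))
      drop-1 : ∀ {x y z} → x ≈ 1# * y + z → x ≈ y + z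
      drop-1 eq = trans eq (+-congʳ (*-identityˡ _))
      splitʳ : ∀ x → Φ (Z x w) ≈ Φ (Z x u) + Φ (Z x v)
      splitʳ x = drop-1 (linear j 1# (Z x w) (Z x u) (Z x v)
        (λ k k≢j → at (Z-j x w u k k≢j)) (λ k k≢j → at (Z-j x w v k k≢j))
        (λ r → trans (at (Zⱼ x w) r)
          (sym (+-cong (*-congˡ (at (Zⱼ x u) r)) (at (Zⱼ x v) r)))))
      splitˡ : Φ (Z w w) ≈ Φ (Z u w) + Φ (Z v w)
      splitˡ = drop-1 (linear i 1# (Z w w) (Z u w) (Z v w)
        (λ k k≢i → at (Z-i w u w k k≢i)) (λ k k≢i → at (Z-i w v w k k≢i))
        (λ r → trans (at (Zᵢ w w) r)
          (sym (+-cong (*-congˡ (at (Zᵢ u w) r)) (at (Zᵢ v w) r)))))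

    alternating-symbol : AlternatingSymbol (λ f → Φ (e ∘ f))
    alternating-symbol = record
      { cong   = λ f≗g → cong λ k r → at (f≗g k) r
      ; repeat = λ ij f fᵢ≡fⱼ → alternating ij (e ∘ f) (at fᵢ≡fⱼ)
      ; swap   = λ ij f g p q r eq → trans (sym (+-identityʳ _)) (trans (+-congˡ (sym eq))
          (alternating-swap ij (e ∘ f) (e ∘ g) (at p) (at q) (λ k k≢i k≢j → at (r k k≢i k≢j))))
      }
      where
      at : ∀ {i j : Fin m} → i ≡ j → e i ≋ e j
      at ≡.refl r = refl

  linear-zero : ∀ {n} (L : V n → R) → (∀ {u v} → u ≋ v → L u ≈ L v) →
                (∀ a u v → L (λ i → a * u i + v i) ≈ a * L u + L v) →
                (∀ i → L (e i) ≈ 0#) → ∀ u → L u ≈ 0#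
  -- In dimension 0 all vectors agree, so linearity reads L u = L u + L u.
  linear-zero {zero}  L L-cong L-lin L-e u = begin
    L u                   ≈⟨ solve 2 (λ o l → l := o :* l :+ l :- o :* l) refl 1# (L u) ⟩
    1# * L u + L u - 1# * L u ≈⟨ +-cong (trans (sym (L-lin 1# u u)) (L-cong λ ())) (-‿cong (*-identityˡ (L u))) ⟩
    L u - L u             ≈⟨ -‿inverseʳ _ ⟩
    0#                    ∎
  linear-zero {suc n} L L-cong L-lin L-e u = begin
    L u                                              ≈⟨ L-cong split ⟩
    L (λ i → u zero * e zero i + (0# Vector.∷ u ∘ suc) i) ≈⟨ L-lin (u zero) (e zero) (0# Vector.∷ u ∘ suc) ⟩
    u zero * L (e zero) + L (0# Vector.∷ u ∘ suc)    ≈⟨ +-cong (trans (*-congˡ (L-e zero)) (zeroʳ _)) tail-zero ⟩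
    0# + 0#                                          ≈⟨ +-identityˡ 0# ⟩
    0#                                               ∎
    where
    split : u ≋ (λ i → u zero * e zero i + (0# Vector.∷ u ∘ suc) i)
    split zero    = sym (trans (+-identityʳ _) (*-identityʳ _))
    split (suc i) = sym (trans (+-congʳ (zeroʳ _)) (+-identityˡ _))
    tail-zero : L (0# Vector.∷ u ∘ suc) ≈ 0#
    tail-zero = linear-zero (λ v → L (0# Vector.∷ v))
      (λ u≋v → L-cong λ { zero → refl ; (suc i) → u≋v i })
      (λ a v w → trans (L-cong λ { zero → sym (trans (+-identityʳ _) (zeroʳ a)) ; (suc i) → refl })
        (L-lin a (0# Vector.∷ v) (0# Vector.∷ w)))
      (λ i → trans (L-cong λ { zero → refl ; (suc j) → refl }) (L-e (suc i)))
      (u ∘ suc)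

  -- Multilinear expansion one argument at a time: with the first argument fixed the form is
  -- alternating in the others, which reduces them to basis vectors; then the first argument is
  -- reduced by linearity.
  alternating-zero : ∀ {m n} {Φ : (Fin n → V m) → R} → Alternating Φ →
                     (∀ f → Φ (e ∘ f) ≈ 0#) → ∀ X → Φ X ≈ 0#
  alternating-zero {n = zero}  Φ-alt Φ-e X = trans (Alternating.cong Φ-alt λ ()) (Φ-e λ ())
  alternating-zero {n = suc n} {Φ} Φ-alt Φ-e X = trans (cong λ { zero r → refl ; (suc j) r → refl })
    (alternating-zero tail-alt (λ g → linear-zero (λ u → Φ (u Vector.∷ e ∘ g))
      (λ u≋v → cong λ { zero → u≋v ; (suc j) r → refl })
      (λ a u v → linear zero a _ _ _ (λ { zero 0≢0 → contradiction ≡.refl 0≢0 ; (suc k) _ r → refl })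
        (λ { zero 0≢0 → contradiction ≡.refl 0≢0 ; (suc k) _ r → refl }) (λ r → refl))
      (λ i → trans (cong λ { zero r → refl ; (suc j) r → refl }) (Φ-e (i Vector.∷ g)))
      (X zero))
      (X ∘ suc))
    where
    open Alternating Φ-alt
    tail-alt : Alternating (λ Y → Φ (X zero Vector.∷ Y))
    tail-alt = record
      { cong        = λ Y≋Z → cong λ { zero r → refl ; (suc j) → Y≋Z j }
      ; linear      = λ j a Y Z W p q eq → linear (suc j) a _ _ _
          (λ { zero _ r → refl ; (suc k) k≢j → p k (k≢j ∘ ≡.cong suc) })
          (λ { zero _ r → refl ; (suc k) k≢j → q k (k≢j ∘ ≡.cong suc) }) eq
      ; alternating = λ ij Y eq → alternating (there ij) _ eq
      }

  alternating-unique : ∀ {n} {Φ : (Fin n → V n) → R} → Alternating Φ → Φ e ≈ 0# → ∀ X → Φ X ≈ 0#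
  alternating-unique Φ-alt Φ-e = alternating-zero Φ-alt (symbol-unique (alternating-symbol Φ-alt) Φ-e)

  -- As functions of the columns `X` both sides are alternating, hence so is their difference, which
  -- vanishes when `X` is the standard basis.
  det-⊙ : ∀ {n} (N X : Fin n → V n) → detᶜ (λ j → N ⊙ X j) ≈ det N * detᶜ X
  det-⊙ {n} N X = x∙y⁻¹≈ε⇒x≈y _ _ (alternating-unique difference-alt at-e X)
    where
    difference-alt : Alternating (λ X → detᶜ (λ j → N ⊙ X j) - det N * detᶜ X)
    difference-alt = record
      { cong        = λ X≋Y → +-cong (det-cong λ i j → ·-congˡ (N i) (X≋Y j))
          (-‿cong (*-congˡ (det-cong λ i j → X≋Y j i)))
      ; linear      = λ j a X Y Z p q eq → trans
          (+-cong (detᶜ-linear j a (λ j → N ⊙ X j) (λ j → N ⊙ Y j) (λ j → N ⊙ Z j)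
                    (λ k k≢j i → ·-congˡ (N i) (p k k≢j)) (λ k k≢j i → ·-congˡ (N i) (q k k≢j))
                    (λ i → trans (·-congˡ (N i) eq) (·-linear (N i) a (Y j) (Z j))))
                  (-‿cong (*-congˡ (detᶜ-linear j a X Y Z p q eq))))
          (solve 6 (λ a d y z y′ z′ → a :* y :+ z :- d :* (a :* y′ :+ z′) := a :* (y :- d :* y′) :+ (z :- d :* z′)) refl
             a (det N) (detᶜ (λ j → N ⊙ Y j)) (detᶜ (λ j → N ⊙ Z j)) (detᶜ Y) (detᶜ Z))
      ; alternating = λ {i} {j} ij X eq → trans
          (+-cong (detᶜ-alternating ij (λ j → N ⊙ X j) (λ i → ·-congˡ (N i) eq))
                  (-‿cong (trans (*-congˡ (detᶜ-alternating ij X eq)) (zeroʳ _))))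
          (-‿inverseʳ 0#)
      }
    at-e : detᶜ (λ j → N ⊙ e j) - det N * detᶜ (e {n}) ≈ 0#
    at-e = x≈y⇒x-y≈0 (begin
      detᶜ (λ j → N ⊙ e j)     ≈⟨ det-cong (λ i j → ·e (N i) j) ⟩
      det N                    ≈⟨ *-identityʳ (det N) ⟨
      det N * 1#               ≈⟨ *-congˡ (trans (det-cong {n} λ i j → e-sym j i) (det-e {n})) ⟨
      det N * detᶜ (e {n})     ∎)

  rightInverse⇒det≉0 : ∀ {n} {N Q : Fin n → V n} → RightInverse N Q → det N ≉ 0#
  rightInverse⇒det≉0 {n} {N} {Q} NQ≋1 det≈0 = 1≉0 (begin
    1#                           ≈⟨ det-e {n} ⟨
    det (e {n})                        ≈⟨ det-cong (λ i j → trans (e-sym i j) (sym (NQ≋1 j i))) ⟩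
    detᶜ (λ j → N ⊙ flip Q j)    ≈⟨ det-⊙ N (flip Q) ⟩
    det N * det Q                ≈⟨ trans (*-congʳ det≈0) (zeroˡ (det Q)) ⟩
    0#                           ∎)

  -- Transposing N Q = I gives Qᵀ Nᵀ = I, to which multiplicativity applies with `detᶜ N` as the
  -- determinant of Nᵀ.
  rightInverse⇒detᶜ≉0 : ∀ {n} {N Q : Fin n → V n} → RightInverse N Q → detᶜ N ≉ 0#
  rightInverse⇒detᶜ≉0 {n} {N} {Q} NQ≋1 detᶜ≈0 = 1≉0 (begin
    1#                           ≈⟨ det-e {n} ⟨
    det (e {n})                  ≈⟨ det-cong (λ i j → trans (sym (NQ≋1 i j)) (·-comm (N j) (flip Q i))) ⟩
    detᶜ (λ j → flip Q ⊙ N j)    ≈⟨ det-⊙ (flip Q) N ⟩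
    detᶜ Q * detᶜ N              ≈⟨ trans (*-congˡ detᶜ≈0) (zeroʳ _) ⟩
    0#                           ∎)

-- Cancelling a linear factor from a polynomial function

-- Right differentiability with a bounded difference quotient is all that is needed
-- of polynomial functions, to evaluate a quotient f x / (x - a) at a itself.
module Differentiability {c ℓ₁ ℓ₂} (F : OrderedField c ℓ₁ ℓ₂) where

  open FieldProperties F
  open Spectra F using (det)
  open Algebra.Definitions.RawSemiring (Semiring.rawSemiring semiring) using (_^_)
  open import Relation.Binary.Reasoning.Setoid setoid

  -- The square stands in for the absolute value. The bound is asked for on [0, 1] alone, since
  -- small steps to the right suffice.
  Bounded : (R → R) → Set _
  Bounded g = ∃ λ C → 0# ≤ C × (∀ h → 0# ≤ h → h ≤ 1# → g h * g h ≤ C)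

  bounded-const : ∀ a → Bounded (λ _ → a)
  bounded-const a = a * a , 0≤x*x a , λ _ _ _ → ≤-refl

  bounded-id : Bounded (λ h → h)
  bounded-id = 1# , 0≤1 , λ h 0≤h h≤1 → ≤-trans (*-monoˡ-≤ 0≤h h≤1) (≤-respˡ (sym (*-identityʳ h)) h≤1)

  -- (f + g)² ≤ 2 (f² + g²), the difference of the two sides being (f - g)².
  bounded-+ : ∀ {f g} → Bounded f → Bounded g → Bounded (λ h → f h + g h)
  bounded-+ {f} {g} (C , 0≤C , f≤C) (D , 0≤D , g≤D) =
    (C + D) + (C + D) , +-nonNegative (+-nonNegative 0≤C 0≤D) (+-nonNegative 0≤C 0≤D) , λ h 0≤h h≤1 →
      let fg≤ = +-mono-≤ (f≤C h 0≤h h≤1) (g≤D h 0≤h h≤1) in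
      ≤-trans (0≤y-x⇒x≤y (≤-respʳ
        (solve 2 (λ f g → (f :- g) :* (f :- g) :=
          ((f :* f :+ g :* g) :+ (f :* f :+ g :* g)) :- (f :+ g) :* (f :+ g)) refl (f h) (g h))
        (0≤x*x (f h - g h))))
      (+-mono-≤ fg≤ fg≤)

  bounded-* : ∀ {f g} → Bounded f → Bounded g → Bounded (λ h → f h * g h)
  bounded-* {f} {g} (C , 0≤C , f≤C) (D , 0≤D , g≤D) = C * D , *-nonNegative 0≤C 0≤D , λ h 0≤h h≤1 →
    ≤-respˡ (solve 2 (λ f g → (f :* f) :* (g :* g) := (f :* g) :* (f :* g)) refl (f h) (g h))
      (≤-trans (*-monoˡ-≤ (0≤x*x (f h)) (g≤D h 0≤h h≤1))
        (≤-respˡ (*-comm D (f h * f h)) (≤-respʳ (*-comm D C) (*-monoˡ-≤ 0≤D (f≤C h 0≤h h≤1)))))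

  record Differentiable (f : R → R) (a : R) : Set (c Level.⊔ ℓ₁ Level.⊔ ℓ₂) where
    constructor differentiable
    field
      quotient  : R → R
      expansion : ∀ h → f (a + h) ≈ f a + h * quotient h
      bounded   : Bounded quotient

  private
    variable
      f g : R → R
      a : R

  differentiable-const : ∀ b → Differentiable (λ _ → b) a
  differentiable-const b = differentiable (λ _ → 0#) (λ h → sym (trans (+-congˡ (zeroʳ h)) (+-identityʳ b))) (bounded-const 0#)

  differentiable-id : Differentiable (λ x → x) a
  differentiable-id = differentiable (λ _ → 1#) (λ h → +-congˡ (sym (*-identityʳ h))) (bounded-const 1#)

  differentiable-+ : Differentiable f a → Differentiable g a → Differentiable (λ x → f x + g x) a
  differentiable-+ {f} {a} {g} (differentiable f′ p bf) (differentiable g′ q bg) = differentiable (λ h → f′ h + g′ h)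
    (λ h → trans (+-cong (p h) (q h))
      (solve 5 (λ f g h f′ g′ → (f :+ h :* f′) :+ (g :+ h :* g′) := (f :+ g) :+ h :* (f′ :+ g′)) refl
        (f a) (g a) h (f′ h) (g′ h)))
    (bounded-+ bf bg)

  differentiable-* : Differentiable f a → Differentiable g a → Differentiable (λ x → f x * g x) a
  differentiable-* {f} {a} {g} (differentiable f′ p bf) (differentiable g′ q bg) = differentiable
    (λ h → (f a * g′ h + g a * f′ h) + h * (f′ h * g′ h))
    (λ h → trans (*-cong (p h) (q h))
      (solve 5 (λ f g h f′ g′ → (f :+ h :* f′) :* (g :+ h :* g′) :=
        f :* g :+ h :* ((f :* g′ :+ g :* f′) :+ h :* (f′ :* g′))) refl (f a) (g a) h (f′ h) (g′ h)))
    (bounded-+ (bounded-+ (bounded-* (bounded-const (f a)) bg) (bounded-* (bounded-const (g a)) bf))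
      (bounded-* bounded-id (bounded-* bf bg)))

  differentiable-sum : ∀ {n} {f : R → Fin n → R} → (∀ i → Differentiable (λ x → f x i) a) →
                       Differentiable (λ x → sum (f x)) a
  differentiable-sum {n = zero}  df = differentiable-const 0#
  differentiable-sum {n = suc n} df = differentiable-+ (df zero) (differentiable-sum (df ∘ suc))

  differentiable-product : ∀ {n} {f : R → Fin n → R} → (∀ i → Differentiable (λ x → f x i) a) →
                           Differentiable (λ x → product (f x)) a
  differentiable-product {n = zero}  df = differentiable-const 1#
  differentiable-product {n = suc n} df = differentiable-* (df zero) (differentiable-product (df ∘ suc))

  differentiable-det : ∀ {n} {A : R → Fin n → Fin n → R} → (∀ i j → Differentiable (λ x → A x i j) a) →
                       Differentiable (λ x → det (A x)) a
  differentiable-det {n = zero}  dA = differentiable-const 1#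
  differentiable-det {n = suc n} {A} dA = differentiable-sum λ j →
    differentiable-* (differentiable-* (differentiable-const ((- 1#) ^ toℕ j)) (dA zero j))
      (differentiable-det λ r s → dA (suc r) (punchIn j s))

  -- For h ≠ 0 the hypothesis gives f (a + h) = 0, so f a = - h g(h) with g the difference quotient,
  -- and D = (f a)² = h² g(h)² ≤ h C for 0 < h ≤ 1. If D were not 0, a small enough h would
  -- contradict this.
  [x-a]f≈0⇒f≈0 : Differentiable f a → (∀ x → (x - a) * f x ≈ 0#) → f a ≈ 0#
  [x-a]f≈0⇒f≈0 {f} {a} (differentiable g expansion (C , 0≤C , g²≤C)) eq with f a ≟ 0#
  ... | yes fa≈0 = fa≈0
  ... | no  fa≉0 = contradiction D*D≈0 (x*y≉0 D≉0 D≉0)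
    where
    D = f a * f a
    -- The step is h = D / (D + C): it lies in (0, 1], and D ≤ h C becomes (D + C) D ≤ D C, hence D²
    -- ≤ 0.
    E = D + C
    0≤D : 0# ≤ D
    0≤D = 0≤x*x (f a)
    D≉0 : D ≉ 0#
    D≉0 = x*y≉0 fa≉0 fa≉0
    E-inverse = inverse E (D≉0 ∘ x+y≈0⇒x≈0 0≤D 0≤C)
    E⁻¹ = proj₁ E-inverse
    0≤E⁻¹ : 0# ≤ E⁻¹
    0≤E⁻¹ = ≤-respʳ (begin
      E * (E⁻¹ * E⁻¹)   ≈⟨ *-assoc E E⁻¹ E⁻¹ ⟨
      E * E⁻¹ * E⁻¹     ≈⟨ *-congʳ (proj₂ E-inverse) ⟩
      1# * E⁻¹          ≈⟨ *-identityˡ E⁻¹ ⟩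
      E⁻¹               ∎) (*-nonNegative (+-nonNegative 0≤D 0≤C) (0≤x*x E⁻¹))
    h = E⁻¹ * D
    0≤h : 0# ≤ h
    0≤h = *-nonNegative 0≤E⁻¹ 0≤D
    h≤1 : h ≤ 1#
    h≤1 = ≤-respʳ (trans (*-comm E⁻¹ E) (proj₂ E-inverse))
      (*-monoˡ-≤ 0≤E⁻¹ (≤-respˡ (+-identityʳ D) (+-monoʳ-≤ D 0≤C)))
    E*h≈D : E * h ≈ D
    E*h≈D = trans (sym (*-assoc E E⁻¹ D)) (trans (*-congʳ (proj₂ E-inverse)) (*-identityˡ D))
    h≉0 : h ≉ 0#
    h≉0 h≈0 = D≉0 (trans (sym E*h≈D) (trans (*-congˡ h≈0) (zeroʳ E)))
    fa+hg≈0 : f a + h * g h ≈ 0#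
    fa+hg≈0 = trans (sym (expansion h)) (x*y≈0⇒y≈0 h≉0
      (trans (*-congʳ (solve 2 (λ a h → h := a :+ h :- a) refl a h)) (eq (a + h))))
    D≈hhgg : D ≈ h * (h * (g h * g h))
    D≈hhgg = begin
      f a * f a
        ≈⟨ solve 3 (λ f h g → f :* f := (f :+ h :* g) :* (f :- h :* g) :+ h :* (h :* (g :* g))) refl (f a) h (g h) ⟩
      (f a + h * g h) * (f a - h * g h) + h * (h * (g h * g h))
        ≈⟨ +-congʳ (trans (*-congʳ fa+hg≈0) (zeroˡ _)) ⟩
      0# + h * (h * (g h * g h))
        ≈⟨ +-identityˡ _ ⟩
      h * (h * (g h * g h)) ∎
    D≤h*C : D ≤ h * C
    D≤h*C = ≤-respˡ (sym D≈hhgg) (*-monoˡ-≤ 0≤h (≤-trans (*-monoˡ-≤ 0≤h (g²≤C h 0≤h h≤1))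
      (≤-respˡ (*-comm C h) (≤-respʳ (*-identityʳ C) (*-monoˡ-≤ 0≤C h≤1)))))
    E*D≤D*C : E * D ≤ D * C
    E*D≤D*C = ≤-respʳ (trans (sym (*-assoc E h C)) (*-congʳ E*h≈D)) (*-monoˡ-≤ (+-nonNegative 0≤D 0≤C) D≤h*C)
    D*D≈0 : D * D ≈ 0#
    D*D≈0 = x+y≈0⇒x≈0 (0≤x*x D) (x≤y⇒0≤y-x E*D≤D*C)
      (solve 2 (λ D C → D :* D :+ (D :* C :- (D :+ C) :* D) := con (0 , 0)) refl D C ⟨ trans ⟩ -‿inverseʳ 0#)

-- Bases extending a vector; vanishing determinants and kernels

module Frame {c ℓ₁ ℓ₂} (F : OrderedField c ℓ₁ ℓ₂) where

  open FieldProperties F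
  open LinearAlgebra F
  open Determinant F
  open Spectra F using (det)
  open import Relation.Binary.Reasoning.Setoid setoid

  module _ {n} (v : V (suc n)) (p : Fin (suc n)) (vₚ≉0 : v p ≉ 0#) (a : V n) where

    -- In the standard basis `v` takes the place of the vector at `p`, where it has a nonzero
    -- coordinate. The coefficients `a` are free, and are later chosen to make the other vectors
    -- orthogonal to `v`.
    frame : Fin (suc n) → V (suc n)
    frame zero    k = v k
    frame (suc i) k = a i * v k + e (punchIn p i) k

    private
      expand : ∀ y k → (flip frame ⊙ y) k ≈
               v k * (y zero + a · (y ∘ suc)) + sum (λ i → e (punchIn p i) k * y (suc i))
      expand y k = begin
        v k * y zero + sum (λ i → (a i * v k + e (punchIn p i) k) * y (suc i))
          ≈⟨ +-congˡ (trans (sum-cong λ i →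
               solve 4 (λ a v e y → (a :* v :+ e) :* y := v :* (a :* y) :+ e :* y) refl
                 (a i) (v k) (e (punchIn p i) k) (y (suc i)))
               (sum-linear (v k) (λ i → a i * y (suc i)) (λ i → e (punchIn p i) k * y (suc i)))) ⟩
        v k * y zero + (v k * a · (y ∘ suc) + sum (λ i → e (punchIn p i) k * y (suc i)))
          ≈⟨ solve 4 (λ v y s t → v :* y :+ (v :* s :+ t) := v :* (y :+ s) :+ t) refl
               (v k) (y zero) (a · (y ∘ suc)) (sum (λ i → e (punchIn p i) k * y (suc i))) ⟩
        v k * (y zero + a · (y ∘ suc)) + sum (λ i → e (punchIn p i) k * y (suc i)) ∎

    -- At coordinate `p` only the multiples of `v` contribute, so their total coefficient `s` is 0.
    -- Each other coordinate then shows a single `y (suc i)`, and `y zero` follows from `s`.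
    frame-injective : ∀ y → (∀ k → (flip frame ⊙ y) k ≈ 0#) → ∀ i → y i ≈ 0#
    frame-injective y eq = λ { zero → y₀≈0 ; (suc i) → yᵢ≈0 i }
      where
      s = y zero + a · (y ∘ suc)
      s≈0 : s ≈ 0#
      s≈0 = x*y≈0⇒y≈0 vₚ≉0 (begin
        v p * s   ≈⟨ +-identityʳ _ ⟨
        v p * s + 0#
          ≈⟨ +-congˡ (sum-zero λ i → trans (*-congʳ (eᵢⱼ≈0 (punchInᵢ≢i p i))) (zeroˡ (y (suc i)))) ⟨
        v p * s + sum (λ i → e (punchIn p i) p * y (suc i))
                  ≈⟨ trans (sym (expand y p)) (eq p) ⟩
        0#        ∎)
      yᵢ≈0 : ∀ i → y (suc i) ≈ 0#
      yᵢ≈0 i = begin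
        y (suc i)   ≈⟨ trans (sum-single i λ j j≢i → trans
                         (*-congʳ (eᵢⱼ≈0 (j≢i ∘ punchIn-injective p j i))) (zeroˡ (y (suc j))))
                         (trans (*-congʳ (eᵢᵢ≈1 (punchIn p i))) (*-identityˡ (y (suc i)))) ⟨
        sum (λ j → e (punchIn p j) (punchIn p i) * y (suc j))
                    ≈⟨ trans (+-congʳ (trans (*-congˡ s≈0) (zeroʳ (v (punchIn p i))))) (+-identityˡ _) ⟨
        v (punchIn p i) * s + sum (λ j → e (punchIn p j) (punchIn p i) * y (suc j))
                    ≈⟨ trans (sym (expand y (punchIn p i))) (eq (punchIn p i)) ⟩
        0#          ∎
      y₀≈0 : y zero ≈ 0#
      y₀≈0 = trans (sym (trans (+-congˡ (·-zeroʳ a yᵢ≈0)) (+-identityʳ (y zero)))) s≈0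

    frame-inverse : ∃ (RightInverse (flip frame))
    frame-inverse with kernel-or-inverse (flip frame)
    ... | inj₁ (y , (i , yᵢ≉0) , eq) = contradiction (frame-injective y eq i) yᵢ≉0
    ... | inj₂ Q                     = Q

    detᶜ-frame≉0 : detᶜ frame ≉ 0#
    detᶜ-frame≉0 = rightInverse⇒det≉0 {N = flip frame} {proj₁ frame-inverse} (proj₂ frame-inverse)

    det-frame≉0 : det frame ≉ 0#
    det-frame≉0 = rightInverse⇒detᶜ≉0 {N = flip frame} {proj₁ frame-inverse} (proj₂ frame-inverse)

  -- In a basis that begins with `v` the first column of the matrix vanishes, and the determinant of
  -- the basis can be cancelled.
  kernel⇒det≈0 : ∀ {n} {N : Fin n → V n} {v} → Kernel N v → det N ≈ 0#
  kernel⇒det≈0 {suc n} {N} {v} ((p , vₚ≉0) , Nv≈0) =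
    x*y≈0⇒y≈0 (detᶜ-frame≉0 v p vₚ≉0 (λ _ → 0#)) (begin
      detᶜ C * det N             ≈⟨ *-comm _ (det N) ⟩
      det N * detᶜ C             ≈⟨ det-⊙ N C ⟨
      -- The zero column is - 1 times itself plus itself, so linearity in it turns the determinant
      -- into - D + D.
      detᶜ (λ j → N ⊙ C j)       ≈⟨ detᶜ-linear zero (- 1#) NC NC NC (λ _ _ _ → refl) (λ _ _ _ → refl)
                                      (λ i → trans (Nv≈0 i) (sym (trans (+-cong (trans (*-congˡ (Nv≈0 i)) (zeroʳ _)) (Nv≈0 i)) (+-identityʳ 0#)))) ⟩
      - 1# * detᶜ NC + detᶜ NC   ≈⟨ trans (+-congʳ (trans (sym (-‿distribˡ-* 1# _)) (-‿cong (*-identityˡ _)))) (-‿inverseˡ _) ⟩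
      0#                         ∎)
    where
    C = frame v p vₚ≉0 (λ _ → 0#)
    NC : Fin (suc n) → V (suc n)
    NC j = N ⊙ C j

  det≈0⇒kernel : ∀ {n} {N : Fin n → V n} → det N ≈ 0# → ∃ (Kernel N)
  det≈0⇒kernel {N = N} det≈0 with kernel-or-inverse N
  ... | inj₁ k          = k
  ... | inj₂ (Q , NQ≋1) = contradiction det≈0 (rightInverse⇒det≉0 {N = N} {Q} NQ≋1)

  det-gram : ∀ {n} (M C : Fin n → V n) → det (gram M C) ≈ det C * (det M * detᶜ C)
  det-gram M C = trans (det-⊙ C (λ j → M ⊙ C j)) (*-congˡ (det-⊙ M C))

-- Counting in finite tuples

module _ {a p} {A : Set a} {P : A → Set p} (P? : U.Decidable P) where

  count≤n : ∀ {n} (f : Fin n → A) → count P? (tabulate f) ℕ.≤ n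
  count≤n {zero}  f = z≤n
  count≤n {suc n} f with P? (f zero)
  ... | yes _ = s≤s (count≤n (f ∘ suc))
  ... | no  _ = ℕₚ.m≤n⇒m≤1+n (count≤n (f ∘ suc))

  count<n : ∀ {n} (f : Fin n → A) i → ¬ P (f i) → count P? (tabulate f) ℕ.< n
  count<n f zero ¬Pi with P? (f zero)
  ... | yes Pi = contradiction Pi ¬Pi
  ... | no  _  = s≤s (count≤n (f ∘ suc))
  count<n f (suc i) ¬Pi with P? (f zero)
  ... | yes _ = s≤s (count<n (f ∘ suc) i ¬Pi)
  ... | no  _ = ℕₚ.m<n⇒m<1+n (count<n (f ∘ suc) i ¬Pi)

  1+count<n : ∀ {n} (f : Fin n → A) i j → i ≢ j → ¬ P (f i) → ¬ P (f j) → suc (count P? (tabulate f)) ℕ.< n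
  1+count<n f zero    zero    i≢j ¬Pi ¬Pj = contradiction ≡.refl i≢j
  1+count<n f zero    (suc j) i≢j ¬Pi ¬Pj with P? (f zero)
  ... | yes Pi = contradiction Pi ¬Pi
  ... | no  _  = s≤s (count<n (f ∘ suc) j ¬Pj)
  1+count<n f (suc i) zero    i≢j ¬Pi ¬Pj with P? (f zero)
  ... | yes Pj = contradiction Pj ¬Pj
  ... | no  _  = s≤s (count<n (f ∘ suc) i ¬Pi)
  1+count<n f (suc i) (suc j) i≢j ¬Pi ¬Pj with P? (f zero)
  ... | yes _ = s≤s (1+count<n (f ∘ suc) i j (i≢j ∘ ≡.cong suc) ¬Pi ¬Pj)
  ... | no  _ = ℕₚ.m<n⇒m<1+n (1+count<n (f ∘ suc) i j (i≢j ∘ ≡.cong suc) ¬Pi ¬Pj)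

  0<count : ∀ {n} (f : Fin n → A) i → P (f i) → 0 ℕ.< count P? (tabulate f)
  0<count f zero Pi with P? (f zero)
  ... | yes _  = s≤s z≤n
  ... | no ¬Pi = contradiction Pi ¬Pi
  0<count f (suc i) Pi with P? (f zero)
  ... | yes _ = s≤s z≤n
  ... | no  _ = 0<count (f ∘ suc) i Pi

  0<count⇒∃ : ∀ {n} (f : Fin n → A) → 0 ℕ.< count P? (tabulate f) → ∃ λ i → P (f i)
  0<count⇒∃ {suc n} f 0<c with P? (f zero)
  ... | yes P0 = zero , P0
  ... | no  _  with 0<count⇒∃ (f ∘ suc) 0<c
  ...   | i , Pi = suc i , Pi

  count≡1⇒unique : ∀ {n} (f : Fin n → A) → count P? (tabulate f) ≡ 1 → ∀ i j → P (f i) → P (f j) → i ≡ j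
  count≡1⇒unique f c≡1 zero    zero    Pi Pj = ≡.refl
  count≡1⇒unique f c≡1 zero    (suc j) Pi Pj with P? (f zero)
  ... | yes _  = contradiction (ℕₚ.suc-injective c≡1) (ℕₚ.>⇒≢ (0<count (f ∘ suc) j Pj))
  ... | no ¬Pi = contradiction Pi ¬Pi
  count≡1⇒unique f c≡1 (suc i) zero    Pi Pj with P? (f zero)
  ... | yes _  = contradiction (ℕₚ.suc-injective c≡1) (ℕₚ.>⇒≢ (0<count (f ∘ suc) i Pi))
  ... | no ¬Pj = contradiction Pj ¬Pj
  count≡1⇒unique f c≡1 (suc i) (suc j) Pi Pj with P? (f zero)
  ... | yes _ = contradiction (ℕₚ.suc-injective c≡1) (ℕₚ.>⇒≢ (0<count (f ∘ suc) i Pi))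
  ... | no  _ = ≡.cong suc (count≡1⇒unique (f ∘ suc) c≡1 i j Pi Pj)

  length-filter≡count : ∀ {b} {B : Set b} {n} (g : B → A) (f : Fin n → B) →
                        List.length (List.filter (P? ∘ g) (List.tabulate f)) ≡ count P? (tabulate (g ∘ f))
  length-filter≡count {n = zero}  g f = ≡.refl
  length-filter≡count {n = suc n} g f with P? (g (f zero))
  ... | yes _ = ≡.cong suc (length-filter≡count g (f ∘ suc))
  ... | no  _ = length-filter≡count g (f ∘ suc)

  count-complement : ∀ {n} (f : Fin n → A) → count P? (tabulate f) ℕ.+ count (¬? ∘ P?) (tabulate f) ≡ n
  count-complement {zero}  f = ≡.refl
  count-complement {suc n} f with P? (f zero)
  ... | yes _ = ≡.cong suc (count-complement (f ∘ suc))
  ... | no  _ = ≡.trans (ℕₚ.+-suc _ _) (≡.cong suc (count-complement (f ∘ suc)))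

  count-¬ : ∀ {n} (f : Fin n → A) → count (¬? ∘ P?) (tabulate f) ≡ n ℕ.∸ count P? (tabulate f)
  count-¬ f = ≡.trans (≡.sym (ℕₚ.m+n∸m≡n (count P? (tabulate f)) _))
    (≡.cong (ℕ._∸ count P? (tabulate f)) (count-complement f))

  count-disjoint≤n : ∀ {q} {Q : A → Set q} (Q? : U.Decidable Q) → (∀ {x} → P x → ¬ Q x) →
                     ∀ {n} (f : Fin n → A) → count P? (tabulate f) ℕ.+ count Q? (tabulate f) ℕ.≤ n
  count-disjoint≤n Q? disjoint {zero}  f = z≤n
  count-disjoint≤n Q? disjoint {suc n} f with P? (f zero) | Q? (f zero)
  ... | yes p | yes q = contradiction q (disjoint p)
  ... | yes _ | no  _ = s≤s (count-disjoint≤n Q? disjoint (f ∘ suc))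
  ... | no  _ | yes _ = ≡.subst (ℕ._≤ suc n) (≡.sym (ℕₚ.+-suc _ _)) (s≤s (count-disjoint≤n Q? disjoint (f ∘ suc)))
  ... | no  _ | no  _ = ℕₚ.m≤n⇒m≤1+n (count-disjoint≤n Q? disjoint (f ∘ suc))

  count-disjoint<n : ∀ {q} {Q : A → Set q} (Q? : U.Decidable Q) → (∀ {x} → P x → ¬ Q x) →
                     ∀ {n} (f : Fin n → A) i → ¬ P (f i) → ¬ Q (f i) →
                     count P? (tabulate f) ℕ.+ count Q? (tabulate f) ℕ.< n
  count-disjoint<n Q? disjoint f zero ¬Pi ¬Qi with P? (f zero) | Q? (f zero)
  ... | yes Pi | _      = contradiction Pi ¬Pi
  ... | no _   | yes Qi = contradiction Qi ¬Qi
  ... | no _   | no _   = s≤s (count-disjoint≤n Q? disjoint (f ∘ suc))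
  count-disjoint<n Q? disjoint {suc n} f (suc i) ¬Pi ¬Qi with P? (f zero) | Q? (f zero)
  ... | yes p | yes q = contradiction q (disjoint p)
  ... | yes _ | no  _ = s≤s (count-disjoint<n Q? disjoint (f ∘ suc) i ¬Pi ¬Qi)
  ... | no  _ | yes _ = ≡.subst (ℕ._< suc n) (≡.sym (ℕₚ.+-suc _ _)) (s≤s (count-disjoint<n Q? disjoint (f ∘ suc) i ¬Pi ¬Qi))
  ... | no  _ | no  _ = ℕₚ.m<n⇒m<1+n (count-disjoint<n Q? disjoint (f ∘ suc) i ¬Pi ¬Qi)

-- Simultaneous diagonalisation of two quadratic forms

module Diagonal {c ℓ₁ ℓ₂} (F : OrderedField c ℓ₁ ℓ₂) where

  open FieldProperties F
  open LinearAlgebra F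
  open Determinant F
  open Differentiability F
  open Frame F
  open Spectra F using (det)
  open import Relation.Binary.Reasoning.Setoid setoid

  Definite : ∀ {n} → (Fin n → V n) → Set _
  Definite B = ∀ x → quad B x ≤ 0# → ∀ i → x i ≈ 0#

  record Diagonalisation {n} (A B : Fin n → V n) (eigenvalue : V n) : Set (c Level.⊔ ℓ₁ Level.⊔ ℓ₂) where
    field
      form     : Fin n → V n
      weight   : V n
      weight≥0 : ∀ t → 0# ≤ weight t

    square : V n → V n
    square x t = weight t * (form t · x * form t · x)

    field
      quad-B : ∀ x → quad B x ≈ sum (square x)
      quad-A : ∀ x → quad A x ≈ sum (λ t → eigenvalue t * square x t)

    square≥0 : ∀ x t → 0# ≤ square x t
    square≥0 x t = *-nonNegative (weight≥0 t) (0≤x*x (form t · x))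

  quad-block : ∀ {n} (G : Fin (suc n) → V (suc n)) → (∀ i → G zero (suc i) ≈ 0#) → (∀ i → G (suc i) zero ≈ 0#) →
               ∀ y → quad G y ≈ G zero zero * (y zero * y zero) + quad (λ i j → G (suc i) (suc j)) (y ∘ suc)
  quad-block G row col y = +-cong
    (trans (*-congˡ (trans (+-congˡ (sum-zero λ i → trans (*-congʳ (row i)) (zeroˡ _))) (+-identityʳ _)))
      (solve 2 (λ y g → y :* (g :* y) := g :* (y :* y)) refl (y zero) (G zero zero)))
    (·-congˡ (y ∘ suc) λ i → trans (+-congʳ (trans (*-congʳ (col i)) (zeroˡ _))) (+-identityˡ _))

  -- The first basis vector is orthogonal to the others for both forms, so both are block diagonal.
  -- The coordinates of x in this basis are `dual ⊙ x`, by `dualʳ`.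
  record AdaptedBasis {n} (A B : Fin (suc n) → V (suc n)) (μ : R) : Set (c Level.⊔ ℓ₁) where
    field
      basis      : Fin (suc n) → V (suc n)
      dual       : Fin (suc n) → V (suc n)
      dualʳ      : RightInverse (flip basis) dual
      injective  : ∀ y → (∀ k → (flip basis ⊙ y) k ≈ 0#) → ∀ i → y i ≈ 0#
      det≉0      : det basis ≉ 0#
      detᶜ≉0     : detᶜ basis ≉ 0#
      nonzero    : Nonzero (basis zero)
      B-row      : ∀ i → gram B basis zero (suc i) ≈ 0#
      A-row      : ∀ i → gram A basis zero (suc i) ≈ 0#
      A₀₀        : gram A basis zero zero ≈ μ * gram B basis zero zero

  definite⇒≰0 : ∀ {n} (B : Fin n → V n) → Definite B → ∀ x → Nonzero x → ¬ (quad B x ≤ 0#)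
  definite⇒≰0 B B-def x (i , xᵢ≉0) le = xᵢ≉0 (B-def x le i)

  -- A kernel vector v of μ B - A satisfies A v = μ B v, so a vector that is B-orthogonal to v is
  -- A-orthogonal to it as well.
  adaptedBasis : ∀ {n} {A B : Fin (suc n) → V (suc n)} → SymmetricM A → SymmetricM B → Definite B →
                 ∀ μ → det (λ i j → μ * B i j - A i j) ≈ 0# → AdaptedBasis A B μ
  adaptedBasis {n} {A} {B} A-sym B-sym B-def μ det≈0
    with det≈0⇒kernel {N = λ i j → μ * B i j - A i j} det≈0
  ... | v , (p , vₚ≉0) , eq = record
    { basis     = C
    ; dual      = proj₁ (frame-inverse v p vₚ≉0 a)
    ; dualʳ     = proj₂ (frame-inverse v p vₚ≉0 a)
    ; injective = frame-injective v p vₚ≉0 a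
    ; det≉0     = det-frame≉0 v p vₚ≉0 a
    ; detᶜ≉0    = detᶜ-frame≉0 v p vₚ≉0 a
    ; nonzero   = p , vₚ≉0
    ; B-row     = λ i → trans (symmetric-· B-sym v (C (suc i))) (orthogonal i)
    ; A-row     = A-row
    ; A₀₀       = trans (·-comm v (A ⊙ v)) (trans (μBv· v) (*-congˡ (·-comm (B ⊙ v) v)))
    }
    where
    Av≋μBv : ∀ i → (A ⊙ v) i ≈ μ * (B ⊙ v) i
    Av≋μBv i = sym (x∙y⁻¹≈ε⇒x≈y _ _ (trans (sym (pencil-· μ (B i) (A i) v)) (eq i)))
    β = quad B v
    β-inverse = OrderedField.inverse F β (definite⇒≰0 B B-def v (p , vₚ≉0) ∘ ≤-reflexive)
    β⁻¹ = proj₁ β-inverse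
    -- Gram-Schmidt: `a i` is - B(v, e_k) / B(v, v) for the basis vector e_k with k = `punchIn p i`.
    -- Definiteness makes the denominator invertible.
    a : V n
    a i = - ((B ⊙ v) (punchIn p i) * β⁻¹)
    C : Fin (suc n) → V (suc n)
    C = frame v p vₚ≉0 a
    orthogonal : ∀ i → (B ⊙ v) · C (suc i) ≈ 0#
    orthogonal i = begin
      (B ⊙ v) · C (suc i)
        ≈⟨ ·-linear (B ⊙ v) (a i) v (e (punchIn p i)) ⟩
      a i * (B ⊙ v) · v + (B ⊙ v) · e (punchIn p i)
        ≈⟨ +-cong (*-congˡ (·-comm (B ⊙ v) v)) (·e (B ⊙ v) (punchIn p i)) ⟩
      - ((B ⊙ v) (punchIn p i) * β⁻¹) * β + (B ⊙ v) (punchIn p i)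
        ≈⟨ solve 3 (λ b β⁻¹ β → (:- (b :* β⁻¹)) :* β :+ b := b :- b :* (β :* β⁻¹)) refl
             ((B ⊙ v) (punchIn p i)) β⁻¹ β ⟩
      (B ⊙ v) (punchIn p i) - (B ⊙ v) (punchIn p i) * (β * β⁻¹)
        ≈⟨ x≈y⇒x-y≈0 (sym (trans (*-congˡ (proj₂ β-inverse)) (*-identityʳ _))) ⟩
      0# ∎
    μBv· : ∀ u → (A ⊙ v) · u ≈ μ * (B ⊙ v) · u
    μBv· u = trans (trans (·-congʳ u Av≋μBv) (·-comm (λ i → μ * (B ⊙ v) i) u))
      (trans (·-scale u μ (B ⊙ v)) (*-congˡ (·-comm u (B ⊙ v))))
    A-row : ∀ i → gram A C zero (suc i) ≈ 0#
    A-row i = trans (symmetric-· A-sym v (C (suc i))) (trans (μBv· (C (suc i)))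
      (trans (*-congˡ (orthogonal i)) (zeroʳ μ)))

  module Deflation {n} {A B : Fin (suc n) → V (suc n)} {eigenvalue : V (suc n)} {k : R}
           (A-sym : SymmetricM A) (B-sym : SymmetricM B) (B-def : Definite B) (k≉0 : k ≉ 0#)
           (factors : ∀ x → det (λ i j → x * B i j - A i j) ≈ k * product (λ i → x - eigenvalue i))
           (adapted : AdaptedBasis A B (eigenvalue zero)) where

    open AdaptedBasis adapted renaming (basis to C; dual to Q)
    μ = eigenvalue zero
    β = gram B C zero zero
    β≰0 : ¬ (β ≤ 0#)
    β≰0 = definite⇒≰0 B B-def (C zero) nonzero
    0≤β : 0# ≤ β
    0≤β with total 0# β
    ... | inj₁ 0≤β = 0≤β
    ... | inj₂ β≤0 = contradiction β≤0 β≰0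
    β≉0 : β ≉ 0#
    β≉0 = β≰0 ∘ ≤-reflexive
    β-inverse = OrderedField.inverse F β β≉0
    β⁻¹ = proj₁ β-inverse
    Q″ : Fin n → V (suc n)
    Q″ = Q ∘ suc
    A″ B″ : Fin n → V n
    A″ i j = gram A C (suc i) (suc j)
    B″ i j = gram B C (suc i) (suc j)
    B-col : ∀ i → gram B C (suc i) zero ≈ 0#
    B-col i = trans (gram-symmetric B-sym C (suc i) zero) (B-row i)
    A-col : ∀ i → gram A C (suc i) zero ≈ 0#
    A-col i = trans (gram-symmetric A-sym C (suc i) zero) (A-row i)
    B″-def : Definite B″
    B″-def y le i = injective (0# Vector.∷ y)
      (B-def (flip C ⊙ (0# Vector.∷ y)) (≤-respˡ (sym (begin
        quad B (flip C ⊙ (0# Vector.∷ y))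
          ≈⟨ quad-gram B C (0# Vector.∷ y) ⟩
        quad (gram B C) (0# Vector.∷ y)
          ≈⟨ quad-block (gram B C) B-row B-col (0# Vector.∷ y) ⟩
        β * (0# * 0#) + quad B″ y
          ≈⟨ trans (+-congʳ (trans (*-congˡ (zeroʳ 0#)) (zeroʳ β))) (+-identityˡ _) ⟩
        quad B″ y ∎)) le)) (suc i)
    κ = det C * (k * detᶜ C)
    κ≉0 : κ ≉ 0#
    κ≉0 = x*y≉0 det≉0 (x*y≉0 k≉0 detᶜ≉0)
    pencil : R → Fin n → V n
    pencil x i j = x * B″ i j - A″ i j
    rest : R → R
    rest x = product λ i → x - eigenvalue (suc i)
    gram-pencil : ∀ x i j → gram (λ r s → x * B r s - A r s) C i j ≈ x * gram B C i j - gram A C i j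
    gram-pencil x i j = trans
      (·-congˡ (C i) (λ r → pencil-· x (B r) (A r) (C j)))
      (·-pencil (C i) x (B ⊙ C j) (A ⊙ C j))
    -- The determinant of x B - A in the adapted basis, computed in two ways: its first row is 0 off
    -- the diagonal, which splits off x β - μ β, and multiplicativity yields the given factorisation
    -- times the determinants of the basis.
    det-gram-pencil : ∀ x → (x * β - μ * β) * det (pencil x) ≈ κ * ((x - μ) * rest x)
    det-gram-pencil x = begin
      (x * β - μ * β) * det (pencil x)
        ≈⟨ *-congʳ (+-congˡ (-‿cong A₀₀)) ⟨
      (x * β - gram A C zero zero) * det (pencil x)
        ≈⟨ det-first-row (λ i j → x * gram B C i j - gram A C i j) (λ j →
             trans (+-cong (trans (*-congˡ (B-row j)) (zeroʳ x)) (-‿cong (A-row j))) (-‿inverseʳ 0#)) ⟨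
      det (λ i j → x * gram B C i j - gram A C i j)
        ≈⟨ det-cong (gram-pencil x) ⟨
      det (gram (λ r s → x * B r s - A r s) C)
        ≈⟨ det-gram (λ r s → x * B r s - A r s) C ⟩
      det C * (det (λ r s → x * B r s - A r s) * detᶜ C)
        ≈⟨ *-congˡ (*-congʳ (factors x)) ⟩
      det C * (k * ((x - μ) * rest x) * detᶜ C)
        ≈⟨ solve 4 (λ d k d′ r → d :* (k :* r :* d′) := d :* (k :* d′) :* r) refl
             (det C) k (detᶜ C) ((x - μ) * rest x) ⟩
      κ * ((x - μ) * rest x) ∎
    difference : R → R
    difference x = β * det (pencil x) + - κ * rest x
    [x-μ]difference≈0 : ∀ x → (x - μ) * difference x ≈ 0#
    [x-μ]difference≈0 x = begin
      (x - μ) * (β * det (pencil x) + - κ * rest x)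
        ≈⟨ solve 6 (λ x μ β d κ r → (x :- μ) :* (β :* d :+ (:- κ) :* r) :=
             (x :* β :- μ :* β) :* d :- κ :* ((x :- μ) :* r)) refl x μ β (det (pencil x)) κ (rest x) ⟩
      (x * β - μ * β) * det (pencil x) - κ * ((x - μ) * rest x)
        ≈⟨ x≈y⇒x-y≈0 (det-gram-pencil x) ⟩
      0# ∎
    difference-differentiable : ∀ x → Differentiable difference x
    difference-differentiable x = differentiable-+
      (differentiable-* (differentiable-const β) (differentiable-det {A = pencil} λ i j →
        differentiable-+ (differentiable-* differentiable-id (differentiable-const (B″ i j)))
          (differentiable-const (- A″ i j))))
      (differentiable-* (differentiable-const (- κ)) (differentiable-product {f = λ x i → x - eigenvalue (suc i)} λ i →
        differentiable-+ differentiable-id (differentiable-const (- eigenvalue (suc i)))))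
    -- Away from μ the factor x - μ is cancelled by division; at μ itself the cancellation is the
    -- one for differentiable functions.
    difference≈0 : ∀ x → difference x ≈ 0#
    difference≈0 x with x ≟ μ
    ... | no  x≉μ = x*y≈0⇒y≈0 (x≉μ ∘ x∙y⁻¹≈ε⇒x≈y x μ) ([x-μ]difference≈0 x)
    ... | yes x≈μ = [x-a]f≈0⇒f≈0 (difference-differentiable x) λ y →
      trans (*-congʳ (+-congˡ (-‿cong x≈μ))) ([x-μ]difference≈0 y)
    factors″ : ∀ x → det (pencil x) ≈ (κ * β⁻¹) * rest x
    factors″ x = *-cancelˡ β≉0 (x∙y⁻¹≈ε⇒x≈y _ _ (begin
      β * det (pencil x) - β * (κ * β⁻¹ * rest x)
        ≈⟨ solve 5 (λ β d κ β⁻¹ r → β :* d :- β :* (κ :* β⁻¹ :* r) := β :* d :+ (:- κ) :* r :* (β :* β⁻¹)) refl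
             β (det (pencil x)) κ β⁻¹ (rest x) ⟩
      β * det (pencil x) + - κ * rest x * (β * β⁻¹)
        ≈⟨ +-congˡ (trans (*-congˡ (proj₂ β-inverse)) (*-identityʳ _)) ⟩
      difference x
        ≈⟨ difference≈0 x ⟩
      0# ∎))

    A″-sym : SymmetricM A″
    A″-sym i j = gram-symmetric A-sym C (suc i) (suc j)

    B″-sym : SymmetricM B″
    B″-sym i j = gram-symmetric B-sym C (suc i) (suc j)

    κ″ = κ * β⁻¹

    κ″≉0 : κ″ ≉ 0#
    κ″≉0 = x*y≉0 κ≉0 (λ β⁻¹≈0 → 1≉0 (trans (sym (proj₂ β-inverse)) (trans (*-congˡ β⁻¹≈0) (zeroʳ β))))

    -- The new form is the coordinate along the eigenvector, weighted by its value β under B. The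
    -- forms of the smaller problem are pulled back along the remaining coordinates.
    extend : Diagonalisation A″ B″ (eigenvalue ∘ suc) → Diagonalisation A B eigenvalue
    extend diagonalisation = record
      { form     = form
      ; weight   = weight
      ; weight≥0 = λ { zero → 0≤β ; (suc t) → D.weight≥0 t }
      ; quad-B   = λ x → begin
          quad B x
            ≈⟨ quad-Q B x ⟩
          quad (gram B C) (Q ⊙ x)
            ≈⟨ quad-block (gram B C) B-row B-col (Q ⊙ x) ⟩
          β * ((Q ⊙ x) zero * (Q ⊙ x) zero) + quad B″ (Q″ ⊙ x)
            ≈⟨ +-congˡ (trans (D.quad-B (Q″ ⊙ x)) (sum-cong (square x))) ⟩
          sum (λ t → weight t * (form t · x * form t · x)) ∎
      ; quad-A   = λ x → begin
          quad A x
            ≈⟨ quad-Q A x ⟩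
          quad (gram A C) (Q ⊙ x)
            ≈⟨ quad-block (gram A C) A-row A-col (Q ⊙ x) ⟩
          gram A C zero zero * ((Q ⊙ x) zero * (Q ⊙ x) zero) + quad A″ (Q″ ⊙ x)
            ≈⟨ +-cong (trans (*-congʳ A₀₀) (*-assoc μ β _))
                 (trans (D.quad-A (Q″ ⊙ x)) (sum-cong λ t → *-congˡ (square x t))) ⟩
          sum (λ t → eigenvalue t * (weight t * (form t · x * form t · x))) ∎
      }
      where
      module D = Diagonalisation diagonalisation
      form : Fin (suc n) → V (suc n)
      form zero    = Q zero
      form (suc t) = flip Q″ ⊙ D.form t
      weight : V (suc n)
      weight zero    = β
      weight (suc t) = D.weight t
      square : ∀ x t → D.square (Q″ ⊙ x) t ≈ weight (suc t) * (form (suc t) · x * form (suc t) · x)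
      square x t = *-congˡ (*-cong eq eq)
        where
        eq : D.form t · (Q″ ⊙ x) ≈ form (suc t) · x
        eq = sym (⊙-adjoint (flip Q″) (D.form t) x)
      quad-Q : ∀ M x → quad M x ≈ quad (gram M C) (Q ⊙ x)
      quad-Q M x = trans (quad-cong M λ i → sym (begin
        (flip C ⊙ (Q ⊙ x)) i                      ≈⟨ ⊙-assoc (flip C) (flip Q) x i ⟩
        (λ j → flip C i · flip Q j) · x           ≈⟨ ·-congʳ x (λ j → trans (dualʳ j i) (e-sym j i)) ⟩
        e i · x                                   ≈⟨ e· i x ⟩
        x i                                       ∎)) (quad-gram M C (Q ⊙ x))

  -- An eigenvector for the first root splits off: in an adapted basis both forms are block diagonal.
  diagonalise : ∀ {n} {A B : Fin n → V n} {eigenvalue : V n} {k : R} →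
                SymmetricM A → SymmetricM B → Definite B → k ≉ 0# →
                (∀ x → det (λ i j → x * B i j - A i j) ≈ k * product (λ i → x - eigenvalue i)) →
                Diagonalisation A B eigenvalue
  diagonalise {zero} _ _ _ _ _ = record
    { form = λ () ; weight = λ () ; weight≥0 = λ () ; quad-B = λ _ → refl ; quad-A = λ _ → refl }
  diagonalise {suc n} {A} {B} {eigenvalue} {k} A-sym B-sym B-def k≉0 factors =
    reduce (adaptedBasis A-sym B-sym B-def μ
      (trans (factors μ) (trans (*-congˡ (trans (*-congʳ (-‿inverseʳ μ)) (zeroˡ _))) (zeroʳ k))))
    where
    μ = eigenvalue zero
    reduce : AdaptedBasis A B μ → Diagonalisation A B eigenvalue
    reduce adapted = extend (diagonalise A″-sym B″-sym B″-def κ″≉0 factors″)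
      where open Deflation {eigenvalue = eigenvalue} A-sym B-sym B-def k≉0 factors adapted

-- Counting eigenvalues by bounds on quadratic forms

module Eigenvalues {c ℓ₁ ℓ₂} (F : OrderedField c ℓ₁ ℓ₂) where

  open FieldProperties F
  open LinearAlgebra F
  open Determinant F
  open Frame F
  open Diagonal F
  open Spectra F using (det; diag; charPoly; Spectrum; m_[_,_⟩)
  open Spectrum
  open import Relation.Binary.Reasoning.Setoid setoid

  diag-e : ∀ {n} (d : V n) i j → diag d i j ≈ d i * e i j
  diag-e d i j with i ≟ᶠ j
  ... | yes ≡.refl = sym (trans (*-congˡ (eᵢᵢ≈1 i)) (*-identityʳ (d i)))
  ... | no  i≢j    = sym (trans (*-congˡ (eᵢⱼ≈0 i≢j)) (zeroʳ (d i)))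

  charPoly-e : ∀ {n} (A : Fin n → V n) x → charPoly A x ≈ det (λ i j → x * e i j - A i j)
  charPoly-e {n} A x = det-cong {n} λ i j → +-congʳ { - A i j} (diag-e (λ _ → x) i j)

  e⊙ : ∀ {n} (x : V n) i → (e ⊙ x) i ≈ x i
  e⊙ x i = e· i x

  quad-e : ∀ {n} (x : V n) → quad e x ≈ x · x
  quad-e x = ·-congˡ x (e⊙ x)

  x·x≈0⇒x≈0 : ∀ {n} {x : V n} → x · x ≈ 0# → ∀ i → x i ≈ 0#
  x·x≈0⇒x≈0 {x = x} eq i = x*x≈0⇒x≈0 (sum≈0⇒f≈0 (λ j → 0≤x*x (x j)) eq i)

  definite-e : ∀ {n} → Definite (e {n})
  definite-e x le = x·x≈0⇒x≈0 (antisym (≤-respˡ (quad-e x) le) (sum-nonNegative λ i → 0≤x*x (x i)))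

  diagonalise-spectrum : ∀ {n} {A : Fin n → V n} → SymmetricM A → (σ : Spectrum A) → Diagonalisation A e (eigenvalue σ)
  diagonalise-spectrum {n} {A} A-sym σ = diagonalise A-sym (e-sym {n}) (definite-e {n}) 1≉0 λ x →
    trans (sym (charPoly-e A x)) (trans (factors σ x) (sym (*-identityˡ _)))

  eigenvector⇒eigenvalue : ∀ {n} {A : Fin n → V n} (σ : Spectrum A) μ {v} → Nonzero v →
                           (∀ i → (A ⊙ v) i ≈ μ * v i) → ∃ λ i → eigenvalue σ i ≈ μ
  eigenvector⇒eigenvalue {n} {A} σ μ {v} v≠0 eq
    with product≈0⇒∃≈0 (trans (sym (factors σ μ)) (trans (charPoly-e A μ) (kernel⇒det≈0 {N = λ i j → μ * e i j - A i j} {v}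
      (v≠0 , λ i → trans (pencil-· μ (e i) (A i) v) (trans (+-cong (*-congˡ (e⊙ v i)) (-‿cong (eq i))) (-‿inverseʳ _))))))
  ... | i , μ-λᵢ≈0 = i , sym (x∙y⁻¹≈ε⇒x≈y μ _ μ-λᵢ≈0)

  -- Otherwise some x ≠ 0 satisfies the constraints and is annihilated by the forms of all
  -- eigenvalues from b on, so that its Rayleigh quotient is less than b.
  constrained-bound : ∀ {n} {A : Fin n → V n} → SymmetricM A → (σ : Spectrum A) (b : R) (rows : List (V n)) →
                      (∀ x → All (λ r → r · x ≈ 0#) rows → b * x · x ≤ quad A x) →
                      n ℕ.≤ length rows ℕ.+ length (List.filter (λ t → b ≤? eigenvalue σ t) (List.allFin n))
  constrained-bound {n} {A} A-sym σ b rows lower = ℕₚ.≮⇒≥ λ few → impossible (solution all-rows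
    (≡.subst (ℕ._< n) (≡.sym (≡.trans (Listₚ.length-++ rows) (≡.cong (length rows ℕ.+_) (Listₚ.length-map D.form large)))) few))
    where
    module D = Diagonalisation (diagonalise-spectrum A-sym σ)
    large = List.filter (λ t → b ≤? eigenvalue σ t) (List.allFin n)
    all-rows = rows ++ List.map D.form large
    impossible : ¬ (∃ λ x → Nonzero x × All (λ r → r · x ≈ 0#) all-rows)
    impossible (x , (i , xᵢ≉0) , sol) = xᵢ≉0 (x·x≈0⇒x≈0 (trans x·x≈Σ (sum-zero square≈0)) i)
      where
      x·x≈Σ : x · x ≈ sum (D.square x)
      x·x≈Σ = trans (sym (quad-e x)) (D.quad-B x)
      form≈0 : ∀ t → b ≤ eigenvalue σ t → D.form t · x ≈ 0#
      form≈0 t b≤λ = All.lookup (Allₚ.map⁻ (Allₚ.++⁻ʳ rows sol)) (∈-filter⁺ (λ t → b ≤? eigenvalue σ t) (∈-allFin t) b≤λ)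
      zero-or-small : ∀ t → D.square x t ≈ 0# ⊎ ¬ (b ≤ eigenvalue σ t)
      zero-or-small t with b ≤? eigenvalue σ t
      ... | yes b≤λ = inj₁ (trans (*-congˡ (trans (*-congʳ (form≈0 t b≤λ)) (zeroˡ _))) (zeroʳ _))
      ... | no  b≰λ = inj₂ b≰λ
      gap : V n
      gap t = (b - eigenvalue σ t) * D.square x t
      gap≥0 : ∀ t → 0# ≤ gap t
      gap≥0 t with zero-or-small t
      ... | inj₁ sq≈0 = ≤-reflexive (sym (trans (*-congˡ sq≈0) (zeroʳ _)))
      ... | inj₂ b≰λ with total b (eigenvalue σ t)
      ...   | inj₁ b≤λ = contradiction b≤λ b≰λ
      ...   | inj₂ λ≤b = *-nonNegative (x≤y⇒0≤y-x λ≤b) (D.square≥0 x t)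
      gap-sum : sum gap ≈ b * x · x - quad A x
      gap-sum = begin
        sum gap
          ≈⟨ sum-cong (λ t → solve 3 (λ b l s → (b :- l) :* s := b :* s :- l :* s) refl b (eigenvalue σ t) (D.square x t)) ⟩
        sum (λ t → b * D.square x t - eigenvalue σ t * D.square x t)
          ≈⟨ trans (sum-linear b (D.square x) _) (+-congˡ (sum-neg (λ t → eigenvalue σ t * D.square x t))) ⟩
        b * sum (D.square x) - sum (λ t → eigenvalue σ t * D.square x t)
          ≈⟨ +-cong (*-congˡ x·x≈Σ) (-‿cong (D.quad-A x)) ⟨
        b * x · x - quad A x ∎
      gap≈0 : ∀ t → gap t ≈ 0#
      gap≈0 = sum≈0⇒f≈0 gap≥0 (antisym (≤-respˡ (sym gap-sum)
        (≤-respʳ (-‿inverseʳ (quad A x)) (+-mono-≤ (lower x (Allₚ.++⁻ˡ rows sol)) (≤-refl { - quad A x})))) (sum-nonNegative gap≥0))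
      square≈0 : ∀ t → D.square x t ≈ 0#
      square≈0 t with zero-or-small t
      ... | inj₁ sq≈0 = sq≈0
      ... | inj₂ b≰λ = x*y≈0⇒y≈0 (λ b-λ≈0 → b≰λ (≤-reflexive (x∙y⁻¹≈ε⇒x≈y b _ b-λ≈0))) (gap≈0 t)

  -- By `constrained-bound` at least n - `length rows` eigenvalues are b or more, and the interval
  -- contains none of these. The eigenvalue below `a` is in neither group, which makes the
  -- inequality strict.
  interval-bound : ∀ {n} {A : Fin n → V n} → SymmetricM A → (σ : Spectrum A) (a b : R) (rows : List (V n)) →
                   (∀ x → All (λ r → r · x ≈ 0#) rows → b * x · x ≤ quad A x) →
                   a ≤ b → ∃ (λ i → ¬ (a ≤ eigenvalue σ i)) → m σ [ a , b ⟩ ℕ.< length rows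
  interval-bound {n} A-sym σ a b rows lower a≤b (i , a≰λᵢ) = ℕₚ.+-cancelʳ-< above _ _
    (ℕₚ.<-≤-trans disjoint (≡.subst (λ k → n ℕ.≤ length rows ℕ.+ k) (length-filter≡count (b ≤?_) (eigenvalue σ) (λ t → t))
      (constrained-bound A-sym σ b rows lower)))
    where
    above = count (b ≤?_) (tabulate (eigenvalue σ))
    disjoint : m σ [ a , b ⟩ ℕ.+ above ℕ.< n
    disjoint = count-disjoint<n (λ x → (a ≤? x) ×-dec (x <? b)) (b ≤?_)
      (λ { (_ , x≤b , x≉b) b≤x → x≉b (antisym x≤b b≤x) })
      (eigenvalue σ) i (a≰λᵢ ∘ proj₁) (a≰λᵢ ∘ ≤-trans a≤b)

-- Distances, pendant vertices and stars

open Graph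

module _ {n} (G : Graph n) where

  snoc : ∀ {u v w k} → Walk G u v k → Adj G v w → Walk G u w (suc k)
  snoc nil        vw = step vw nil
  snoc (step a p) vw = step a (snoc p vw)

  reverse : ∀ {u v k} → Walk G u v k → Walk G v u k
  reverse nil        = nil
  reverse (step a p) = snoc (reverse p) (adjSym G a)

  neighbour-unique : ∀ {u v w} → Pendant G u → Adj G u v → Adj G u w → v ≡ w
  neighbour-unique {u} {v} {w} pendant uv uw = count≡1⇒unique (adj? G u) id pendant v w uv uw

  neighbour : ∀ {u} → Pendant G u → ∃ (Adj G u)
  neighbour {u} pendant = 0<count⇒∃ (adj? G u) id (ℕₚ.≤-reflexive (≡.sym pendant))

  module _ (conn : Connected G) where

    private
      d = dist G conn

    dist-walk : ∀ u v → Walk G u v (d u v)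
    dist-walk u v = proj₁ (proj₂ (least (walk? G u v) (proj₁ (conn u v)) (proj₂ (conn u v))))

    dist-minimal : ∀ {u v k} → Walk G u v k → d u v ℕ.≤ k
    dist-minimal {u} {v} {k} = proj₂ (proj₂ (least (walk? G u v) (proj₁ (conn u v)) (proj₂ (conn u v)))) k

    dist-sym : ∀ u v → d u v ≡ d v u
    dist-sym u v = ℕₚ.≤-antisym (dist-minimal (reverse (dist-walk v u))) (dist-minimal (reverse (dist-walk u v)))

    dist-refl : ∀ u → d u u ≡ 0
    dist-refl u = ℕₚ.n≤0⇒n≡0 (dist-minimal nil)

    1≤dist : ∀ {u v} → u ≢ v → 1 ℕ.≤ d u v
    1≤dist {u} {v} u≢v with d u v | dist-walk u v
    ... | zero  | nil = contradiction ≡.refl u≢v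
    ... | suc _ | _   = s≤s z≤n

    2≤dist : ∀ {u v} → u ≢ v → ¬ Adj G u v → 2 ℕ.≤ d u v
    2≤dist {u} {v} u≢v ¬uv with d u v | dist-walk u v
    ... | zero        | nil         = contradiction ≡.refl u≢v
    ... | suc zero    | step uv nil = contradiction uv ¬uv
    ... | suc (suc _) | _           = s≤s (s≤s z≤n)

    adjacent⇒dist≡1 : ∀ {u v} → Adj G u v → d u v ≡ 1
    adjacent⇒dist≡1 uv = ℕₚ.≤-antisym (dist-minimal (step uv nil)) (1≤dist λ u≡v → adjIrr G u≡v uv)

    module _ (G≇K : ¬ (G ≅ K n)) where

      -- Two adjacent pendant vertices would form a component.
      pendants-nonadjacent : ∀ {u v} → Pendant G u → Pendant G v → ¬ Adj G u v
      pendants-nonadjacent {u} {v} pu pv uv = G≇K record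
        { vertices  = ↔-id _
        ; adjacency = λ a b → mk⇔ (λ ab a≡b → adjIrr G a≡b ab) (adjacent (u-or-v a) (u-or-v b))
        }
        where
        from-u : ∀ {w k} → Walk G u w k → w ≡ u ⊎ w ≡ v
        from-v : ∀ {w k} → Walk G v w k → w ≡ u ⊎ w ≡ v
        from-u nil = inj₁ ≡.refl
        from-u (step ua p) with neighbour-unique pu uv ua
        ... | ≡.refl = from-v p
        from-v nil = inj₂ ≡.refl
        from-v (step va p) with neighbour-unique pv (adjSym G uv) va
        ... | ≡.refl = from-u p
        u-or-v : ∀ a → a ≡ u ⊎ a ≡ v
        u-or-v a = from-u (proj₂ (conn u a))
        adjacent : ∀ {a b} → a ≡ u ⊎ a ≡ v → b ≡ u ⊎ b ≡ v → a ≢ b → Adj G a b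
        adjacent (inj₁ ≡.refl) (inj₁ ≡.refl) a≢b = contradiction ≡.refl a≢b
        adjacent (inj₁ ≡.refl) (inj₂ ≡.refl) a≢b = uv
        adjacent (inj₂ ≡.refl) (inj₁ ≡.refl) a≢b = adjSym G uv
        adjacent (inj₂ ≡.refl) (inj₂ ≡.refl) a≢b = contradiction ≡.refl a≢b

      pendant? : ∀ v → Dec (Pendant G v)
      pendant? v = degree G v ℕₚ.≟ 1

      pendant-exists : 1 ℕ.≤ pendantCount G → ∃ (Pendant G)
      pendant-exists = 0<count⇒∃ pendant? id

      nonpendant-exists : 1 ℕ.≤ pendantCount G → ∃ λ v → ¬ Pendant G v
      nonpendant-exists 1≤p with pendant-exists 1≤p
      ... | u , pu with neighbour pu
      ...   | v , uv = v , λ pv → pendants-nonadjacent pu pv uv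

      pendantCount<n : 1 ℕ.≤ pendantCount G → pendantCount G ℕ.< n
      pendantCount<n 1≤p with nonpendant-exists 1≤p
      ... | v , ¬pv = count<n pendant? id v ¬pv

      module _ (p≡n-1 : pendantCount G ≡ n ℕ.∸ 1) {c} (¬pc : ¬ Pendant G c) where

        -- A second nonpendant vertex besides `c` would leave fewer than n - 1 pendant ones.
        pendant : ∀ {v} → v ≢ c → Pendant G v
        pendant {v} v≢c with pendant? v
        ... | yes pv = pv
        ... | no ¬pv = contradiction
          (≡.subst (λ k → suc k ℕ.< n) p≡n-1 (1+count<n pendant? id v c v≢c ¬pv ¬pc))
          (ℕₚ.≤⇒≯ (ℕₚ.m≤n+m∸n n 1))

        through-centre : ∀ {u v} → Adj G u v → u ≡ c ⊎ v ≡ c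
        through-centre {u} {v} uv with u ≟ᶠ c | v ≟ᶠ c
        ... | yes u≡c | _       = inj₁ u≡c
        ... | no  _   | yes v≡c = inj₂ v≡c
        ... | no  u≢c | no  v≢c = contradiction uv (pendants-nonadjacent (pendant u≢c) (pendant v≢c))

        centre-adjacent : ∀ {v} → v ≢ c → Adj G c v
        centre-adjacent {v} v≢c with neighbour (pendant v≢c)
        ... | w , vw with through-centre vw
        ...   | inj₁ v≡c    = contradiction v≡c v≢c
        ...   | inj₂ ≡.refl = adjSym G vw

star : ∀ {n} (G : Graph n) (c : Fin n) → (∀ {u v} → Adj G u v → u ≡ c ⊎ v ≡ c) →
       (∀ {v} → v ≢ c → Adj G c v) → G ≅ S n
star {suc n} G c through-c adjacent-c = record
  { vertices  = transpose c zero
  ; adjacency = λ u v → mk⇔ (to u v) (from u v)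
  }
  where
  π = Components.transpose c zero
  πc≡0 : π c ≡ zero
  πc≡0 with c ≟ᶠ c
  ... | yes _  = ≡.refl
  ... | no c≢c = contradiction ≡.refl c≢c
  πu≡0⇒u≡c : ∀ u → toℕ (π u) ≡ 0 → u ≡ c
  πu≡0⇒u≡c u eq = ≡.trans (≡.sym (Components.transpose-inverse zero c))
    (≡.trans (≡.cong (Components.transpose zero c) (≡.trans (toℕ-injective eq) (≡.sym πc≡0)))
      (Components.transpose-inverse zero c))
  at-c : ∀ {u} → u ≡ c → toℕ (π u) ≡ 0
  at-c ≡.refl = ≡.cong toℕ πc≡0
  to : ∀ u v → Adj G u v → StarAdj (π u) (π v)
  to u v uv with through-c uv
  ... | inj₁ u≡c = inj₁ (at-c u≡c , λ πv≡0 → adjIrr G (≡.trans u≡c (≡.sym (πu≡0⇒u≡c v πv≡0))) uv)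
  ... | inj₂ v≡c = inj₂ (at-c v≡c , λ πu≡0 → adjIrr G (≡.trans (πu≡0⇒u≡c u πu≡0) (≡.sym v≡c)) uv)
  from : ∀ u v → StarAdj (π u) (π v) → Adj G u v
  from u v (inj₁ (πu≡0 , πv≢0)) with πu≡0⇒u≡c u πu≡0
  ... | ≡.refl = adjacent-c (πv≢0 ∘ at-c)
  from u v (inj₂ (πv≡0 , πu≢0)) with πu≡0⇒u≡c v πv≡0
  ... | ≡.refl = adjSym G (adjacent-c (πu≢0 ∘ at-c))

open import Data.Nat using (_+_; _∸_; _≤_)

-- The distance Laplacian and its quadratic form

module DistanceLaplacian {c ℓ₁ ℓ₂} (F : OrderedField c ℓ₁ ℓ₂) {n} (G : Graph n) (conn : Connected G) where

  open FieldProperties F renaming (_+_ to infixl 6 _+ᴿ_; _≤_ to infix 4 _≤ᴿ_)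
  open LinearAlgebra F
  open Eigenvalues F
  open Diagonal F
  open Spectra F using (distanceLaplacian; Spectrum; m_[_,_⟩)
  open Spectrum
  open import Relation.Binary.Reasoning.Setoid setoid

  private
    open Algebra.Definitions.RawMonoid ℕ.+-0-rawMonoid using () renaming (sum to sumℕ)

    fromℕ-sum : ∀ {m} (f : Fin m → ℕ) → fromℕ (sumℕ f) ≈ sum (fromℕ ∘ f)
    fromℕ-sum {zero}  f = refl
    fromℕ-sum {suc m} f = trans (fromℕ-homo-+ (f zero) _) (+-congˡ (fromℕ-sum (f ∘ suc)))

    indicator : ∀ {a} {A : Set a} → Dec A → R
    indicator A? = if does A? then 1# else 0#

    sum-indicator : ∀ {a p} {A : Set a} {P : A → Set p} (P? : U.Decidable P) {m} (f : Fin m → A) →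
                    sum (λ i → indicator (P? (f i))) ≈ fromℕ (count P? (tabulate f))
    sum-indicator P? {zero}  f = refl
    sum-indicator P? {suc m} f with P? (f zero)
    ... | yes _ = +-congˡ (sum-indicator P? (f ∘ suc))
    ... | no  _ = trans (+-identityˡ _) (sum-indicator P? (f ∘ suc))

  L : Fin n → V n
  L = distanceLaplacian G conn

  N : R
  N = fromℕ n

  ones : V n
  ones _ = 1#

  d̂ : Fin n → V n
  d̂ u v = fromℕ (dist G conn u v)

  d̂-sym : SymmetricM d̂
  d̂-sym u v = reflexive (≡.cong fromℕ (dist-sym G conn u v))

  T : V n
  T u = fromℕ (Tr G conn u)

  ·ones : (w : V n) → w · ones ≈ sum w
  ·ones w = sum-cong λ v → *-identityʳ (w v)

  ones·ones : ones · ones ≈ N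
  ones·ones = trans (·ones ones) (sum-ones n)
    where
    sum-ones : ∀ m → sum {m} (λ _ → 1#) ≈ fromℕ m
    sum-ones zero    = refl
    sum-ones (suc m) = +-congˡ (sum-ones m)

  T≈Σd̂ : ∀ u → T u ≈ sum (d̂ u)
  T≈Σd̂ u = trans (fromℕ-sum (λ v → dist G conn v u)) (sum-cong λ v → d̂-sym v u)

  L⊙ : ∀ x u → (L ⊙ x) u ≈ T u * x u - d̂ u · x
  L⊙ x u = begin
    L u · x                              ≈⟨ ·-congʳ x (λ v → +-congʳ (diag-e T u v)) ⟩
    (λ v → T u * e u v - d̂ u v) · x      ≈⟨ pencil-· (T u) (e u) (d̂ u) x ⟩
    T u * e u · x - d̂ u · x              ≈⟨ +-congʳ (*-congˡ (e· u x)) ⟩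
    T u * x u - d̂ u · x                  ∎

  L-sym : SymmetricM L
  L-sym u v = +-cong (trans (diag-e T u v) (trans (Te-sym u v) (sym (diag-e T v u)))) (-‿cong (d̂-sym u v))
    where
    Te-sym : ∀ u v → T u * e u v ≈ T v * e v u
    Te-sym u v with u ≟ᶠ v
    ... | yes ≡.refl = refl
    ... | no  u≢v    = trans (trans (*-congˡ (eᵢⱼ≈0 u≢v)) (zeroʳ _)) (sym (trans (*-congˡ (eᵢⱼ≈0 (u≢v ∘ ≡.sym))) (zeroʳ _)))

  L-ones : ∀ u → (L ⊙ ones) u ≈ 0# * ones u
  L-ones u = begin
    (L ⊙ ones) u              ≈⟨ L⊙ ones u ⟩
    T u * 1# - d̂ u · ones     ≈⟨ +-cong (trans (*-identityʳ (T u)) (T≈Σd̂ u)) (-‿cong (·ones (d̂ u))) ⟩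
    sum (d̂ u) - sum (d̂ u)     ≈⟨ -‿inverseʳ _ ⟩
    0#                        ≈⟨ zeroˡ 1# ⟨
    0# * ones u               ∎

  -- For symmetric `W` this is half of Σ W u v (x u - x v)², written without division. The
  -- asymmetric summand can be evaluated row by row, the doubled symmetric one is monotone in the
  -- weights.
  energy : (Fin n → V n) → V n → R
  energy W x = sum λ u → sum λ v → W u v * (x u * x u - x u * x v)

  energy-row : ∀ (w x : V n) t → sum (λ v → w v * (t * t - t * x v)) ≈ t * (t * sum w - w · x)
  energy-row w x t = begin
    sum (λ v → w v * (t * t - t * x v))
      ≈⟨ sum-cong (λ v → solve 3 (λ w t x → w :* (t :* t :- t :* x) := t :* (t :* w :- w :* x)) refl (w v) t (x v)) ⟩
    sum (λ v → t * (t * w v - w v * x v))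
      ≈⟨ *-distribˡ-sum t (λ v → t * w v - w v * x v) ⟨
    t * sum (λ v → t * w v - w v * x v)
      ≈⟨ *-congˡ (trans (sum-linear t w _) (+-congˡ (sum-neg (λ v → w v * x v)))) ⟩
    t * (t * sum w - w · x) ∎

  -- The second copy of the sum is taken with `u` and `v` exchanged.
  energy-double : ∀ {W} → SymmetricM W → ∀ x →
                  energy W x +ᴿ energy W x ≈ sum (λ u → sum λ v → W u v * ((x u - x v) * (x u - x v)))
  energy-double {W} W-sym x = begin
    energy W x +ᴿ energy W x
      ≈⟨ +-congˡ (trans (∑-comm (λ u v → W u v * (x u * x u - x u * x v)))
           (sum-cong λ u → sum-cong λ v → *-congʳ (W-sym v u))) ⟩
    energy W x +ᴿ sum (λ u → sum λ v → W u v * (x v * x v - x v * x u))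
      ≈⟨ trans (sum-cong λ u → ∑-distrib-+ (λ v → W u v * (x u * x u - x u * x v)) (λ v → W u v * (x v * x v - x v * x u)))
           (∑-distrib-+ (λ u → sum λ v → W u v * (x u * x u - x u * x v)) (λ u → sum λ v → W u v * (x v * x v - x v * x u))) ⟨
    sum (λ u → sum λ v → W u v * (x u * x u - x u * x v) +ᴿ W u v * (x v * x v - x v * x u))
      ≈⟨ sum-cong (λ u → sum-cong λ v →
           solve 3 (λ w x y → w :* (x :* x :- x :* y) :+ w :* (y :* y :- y :* x) := w :* ((x :- y) :* (x :- y))) refl (W u v) (x u) (x v)) ⟩
    sum (λ u → sum λ v → W u v * ((x u - x v) * (x u - x v))) ∎

  -- Diagonal terms contain x u - x u, so the weights are compared off the diagonal only. This
  -- matters for the comparison with distances, where the diagonal entries are 2 against 0.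
  energy-mono : ∀ {W W′} → SymmetricM W → SymmetricM W′ → (∀ u v → u ≢ v → W u v ≤ᴿ W′ u v) →
                ∀ x → energy W x ≤ᴿ energy W′ x
  energy-mono {W} {W′} W-sym W′-sym W≤W′ x = double-≤ (≤-respˡ (sym (energy-double W-sym x))
    (≤-respʳ (sym (energy-double W′-sym x)) (sum-mono-≤ λ u → sum-mono-≤ λ v → bound u v)))
    where
    bound : ∀ u v → W u v * ((x u - x v) * (x u - x v)) ≤ᴿ W′ u v * ((x u - x v) * (x u - x v))
    bound u v with u ≟ᶠ v
    ... | yes ≡.refl = ≤-reflexive (trans (*-congˡ square≈0) (trans (zeroʳ _) (sym (trans (*-congˡ square≈0) (zeroʳ _)))))
      where
      square≈0 : (x u - x u) * (x u - x u) ≈ 0#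
      square≈0 = trans (*-congʳ (-‿inverseʳ (x u))) (zeroˡ _)
    ... | no  u≢v    = ≤-respˡ (*-comm _ _) (≤-respʳ (*-comm _ _) (*-monoˡ-≤ (0≤x*x (x u - x v)) (W≤W′ u v u≢v)))

  quad-L : ∀ x → quad L x ≈ energy d̂ x
  quad-L x = sum-cong λ u → begin
    x u * (L ⊙ x) u                      ≈⟨ *-congˡ (L⊙ x u) ⟩
    x u * (T u * x u - d̂ u · x)          ≈⟨ *-congˡ (+-congʳ (trans (*-comm (T u) (x u)) (*-congˡ (T≈Σd̂ u)))) ⟩
    x u * (x u * sum (d̂ u) - d̂ u · x)    ≈⟨ energy-row (d̂ u) x (x u) ⟨
    sum (λ v → d̂ u v * (x u * x u - x u * x v)) ∎

  module _ (G≇K : ¬ (G ≅ K n)) (1≤p : 1 ≤ pendantCount G) where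

    private
      p = pendantCount G

      two = fromℕ 2

      α : Fin n → V n
      α u v = indicator (adj? G u v)

      α-sym : SymmetricM α
      α-sym u v with adj? G u v | adj? G v u
      ... | yes _  | yes _  = refl
      ... | yes uv | no ¬vu = contradiction (adjSym G uv) ¬vu
      ... | no ¬uv | yes vu = contradiction (adjSym G vu) ¬uv
      ... | no _   | no _   = refl

      -- Distinct vertices are at distance 1 if adjacent and at least 2 otherwise, so 2 - a bounds
      -- the distance from below. The factor `1#` is an entry of `ones`, so that a row is `two`
      -- times `ones` minus a row of `α`, as `pencil-·` expects.
      W : Fin n → V n
      W u v = two * 1# - α u v

      W≤d̂ : ∀ u v → u ≢ v → W u v ≤ᴿ d̂ u v
      W≤d̂ u v u≢v with adj? G u v
      ... | yes _  = ≤-respˡ (sym (trans (+-congʳ (*-identityʳ two)) (solve 2 (λ o t → o :+ t :- o := t) refl 1# (fromℕ 1))))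
        (fromℕ-mono-≤ (1≤dist G conn u≢v))
      ... | no ¬uv = ≤-respˡ (sym (trans (+-cong (*-identityʳ two) ε⁻¹≈ε) (+-identityʳ two)))
        (fromℕ-mono-≤ (2≤dist G conn u≢v ¬uv))

      κ = two * N - 1#

      -- This is p < n: subtracting n + p + 1 from 2n leaves κ - (n + p).
      b≤κ : fromℕ (n + p) ≤ᴿ κ
      b≤κ = 0≤y-x⇒x≤y (≤-respʳ (begin
        fromℕ (n + n) - fromℕ (n + suc p)
          ≈⟨ +-cong (fromℕ-homo-+ n n) (-‿cong (fromℕ-homo-+ n (suc p))) ⟩
        (N +ᴿ N) - (N +ᴿ (1# +ᴿ fromℕ p))
          ≈⟨ solve 3 (λ N o p → (N :+ N) :- (N :+ (o :+ p)) := (N :+ N) :- o :- (N :+ p)) refl N 1# (fromℕ p) ⟩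
        (N +ᴿ N) - 1# - (N +ᴿ fromℕ p)
          ≈⟨ +-cong (+-congʳ (sym two*N)) (-‿cong (sym (fromℕ-homo-+ n p))) ⟩
        κ - fromℕ (n + p) ∎)
        (x≤y⇒0≤y-x (fromℕ-mono-≤ (ℕₚ.+-monoʳ-≤ n (pendantCount<n G conn G≇K 1≤p)))))
        where
        two*N : two * N ≈ N +ᴿ N
        two*N = trans (distribʳ N 1# (fromℕ 1))
          (+-cong (*-identityˡ N) (trans (*-congʳ (+-identityʳ 1#)) (*-identityˡ N)))

    -- A row at `u` contributes x u (x u Σ W u - W u · x). At a pendant vertex the row sum is 2n -
    -- 1, and W u · x is 2 Σ x minus the value of x at the neighbour of `u`, which is not pendant;
    -- both are 0. At other vertices x u = 0.
    energy-W : ∀ x → ones · x ≈ 0# → (∀ v → ¬ Pendant G v → x v ≈ 0#) → energy W x ≈ κ * x · x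
    energy-W x Σx≈0 support = trans (sum-cong row) (sym (*-distribˡ-sum κ (λ u → x u * x u)))
      where
      ΣW≈κ : ∀ {u} → Pendant G u → sum (W u) ≈ κ
      ΣW≈κ {u} pu = begin
        sum (W u)                             ≈⟨ ·ones (W u) ⟨
        W u · ones                            ≈⟨ pencil-· two ones (α u) ones ⟩
        two * ones · ones - α u · ones        ≈⟨ +-cong (*-congˡ ones·ones) (-‿cong (trans (·ones (α u)) (sum-indicator (adj? G u) id))) ⟩
        two * N - fromℕ (degree G u)          ≈⟨ +-congˡ (-‿cong (trans (reflexive (≡.cong fromℕ pu)) (+-identityʳ 1#))) ⟩
        κ                                     ∎
      αx≈0 : ∀ {u} → Pendant G u → ∀ v → α u v * x v ≈ 0#
      αx≈0 {u} pu v with adj? G u v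
      ... | no _   = zeroˡ (x v)
      ... | yes uv = trans (*-congˡ (support v λ pv → pendants-nonadjacent G conn G≇K pu pv uv)) (zeroʳ 1#)
      Wx≈0 : ∀ {u} → Pendant G u → W u · x ≈ 0#
      Wx≈0 {u} pu = begin
        W u · x                       ≈⟨ pencil-· two ones (α u) x ⟩
        two * ones · x - α u · x      ≈⟨ +-cong (trans (*-congˡ Σx≈0) (zeroʳ two)) (-‿cong (sum-zero (αx≈0 pu))) ⟩
        0# - 0#                       ≈⟨ -‿inverseʳ 0# ⟩
        0#                            ∎
      row : ∀ u → sum (λ v → W u v * (x u * x u - x u * x v)) ≈ κ * (x u * x u)
      row u with pendant? G conn G≇K u
      ... | yes pu = begin
        sum (λ v → W u v * (x u * x u - x u * x v))
          ≈⟨ energy-row (W u) x (x u) ⟩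
        x u * (x u * sum (W u) - W u · x)
          ≈⟨ *-congˡ (+-cong (*-congˡ (ΣW≈κ pu)) (trans (-‿cong (Wx≈0 pu)) ε⁻¹≈ε)) ⟩
        x u * (x u * κ +ᴿ 0#)
          ≈⟨ trans (*-congˡ (+-identityʳ _)) (solve 2 (λ x κ → x :* (x :* κ) := κ :* (x :* x)) refl (x u) κ) ⟩
        κ * (x u * x u) ∎
      ... | no ¬pu = trans (energy-row (W u) x (x u)) (trans (trans (*-congʳ xᵤ≈0) (zeroˡ _))
        (sym (trans (*-congˡ (trans (*-congʳ xᵤ≈0) (zeroˡ _))) (zeroʳ κ))))
        where
        xᵤ≈0 = support u ¬pu

    quad-L-bound : ∀ x → ones · x ≈ 0# → (∀ v → ¬ Pendant G v → x v ≈ 0#) → fromℕ (n + p) * x · x ≤ᴿ quad L x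
    quad-L-bound x Σx≈0 support = ≤-respʳ (sym (quad-L x))
      (≤-trans (≤-respˡ (*-comm _ _) (≤-respʳ (*-comm _ _) (*-monoˡ-≤ (sum-nonNegative λ u → 0≤x*x (x u)) b≤κ)))
        (≤-respˡ (energy-W x Σx≈0 support)
          (energy-mono (λ u v → +-congˡ (-‿cong (α-sym u v))) d̂-sym W≤d̂ x)))

    private
      p<n : p ℕ.< n
      p<n = pendantCount<n G conn G≇K 1≤p

      N≰0 : ¬ (N ≤ᴿ 0#)
      N≰0 = 0<n⇒fromℕ≰0 (ℕₚ.≤-<-trans ℕ.z≤n p<n)

      N≤b : N ≤ᴿ fromℕ (n + p)
      N≤b = fromℕ-mono-≤ (ℕₚ.m≤m+n n p)

      nonpendant? : U.Decidable (λ v → ¬ Pendant G v)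
      nonpendant? = ¬? ∘ pendant? G conn G≇K

      nonpendants : List (Fin n)
      nonpendants = List.filter nonpendant? (List.allFin n)

      -- Equations for coordinate sum 0 and for support on the pendant vertices. Their number is n -
      -- p + 1; the strict inequality of `interval-bound` removes the 1.
      rows : List (V n)
      rows = ones ∷ List.map e nonpendants

      length-rows : length rows ≡ suc (n ∸ p)
      length-rows = ≡.cong suc (≡.trans (Listₚ.length-map e nonpendants)
        (≡.trans (length-filter≡count nonpendant? id id) (count-¬ (pendant? G conn G≇K) id)))

      rows-bound : ∀ x → All (λ r → r · x ≈ 0#) rows → fromℕ (n + p) * x · x ≤ᴿ quad L x
      rows-bound x (Σx≈0 ∷ sol) = quad-L-bound x Σx≈0 λ v ¬pv →
        trans (sym (e· v x)) (All.lookup (Allₚ.map⁻ sol) (∈-filter⁺ nonpendant? (∈-allFin v) ¬pv))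

    pendant-interval-bound : (σ : Spectrum L) → m σ [ N , fromℕ (n + p) ⟩ ≤ n ∸ p
    pendant-interval-bound σ = ℕ.s≤s⁻¹ (≡.subst (m σ [ N , fromℕ (n + p) ⟩ ℕ.<_) length-rows
      -- The eigenvalue below the interval is 0, with the all-ones vector as eigenvector.
      (interval-bound L-sym σ N (fromℕ (n + p)) rows rows-bound N≤b (proj₁ zero-eigenvalue , λ N≤λᵢ → N≰0 (≤-respʳ (proj₂ zero-eigenvalue) N≤λᵢ))))
      where
      zero-eigenvalue : ∃ λ i → eigenvalue σ i ≈ 0#
      zero-eigenvalue = eigenvector⇒eigenvalue σ 0# {ones} (proj₁ (pendant-exists G conn G≇K 1≤p) , 1≉0) L-ones

    module _ (p≡n-1 : p ≡ n ∸ 1) (c₀ : Fin n) (¬pc₀ : ¬ Pendant G c₀) where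

      isomorphic-star : G ≅ S n
      isomorphic-star = star G c₀ (through-centre G conn G≇K p≡n-1 ¬pc₀) (centre-adjacent G conn G≇K p≡n-1 ¬pc₀)

      private
        d̂c₀ : ∀ {v} → v ≢ c₀ → d̂ v c₀ ≈ 1#
        d̂c₀ v≢c₀ = trans (d̂-sym _ c₀) (trans
          (reflexive (≡.cong fromℕ (adjacent⇒dist≡1 G conn (centre-adjacent G conn G≇K p≡n-1 ¬pc₀ v≢c₀)))) (+-identityʳ 1#))

        -- Since L annihilates `ones`, L x is - n times column `c₀` of L. That column is n - 1 at
        -- the centre and - 1 elsewhere, so L x has the entries n (1 - n) and n, which are n times
        -- those of x.
        x : V n
        x v = - N * e c₀ v +ᴿ ones v

        x-off-centre : ∀ {u} → u ≢ c₀ → x u ≈ 1#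
        x-off-centre u≢c₀ = trans (+-congʳ (trans (*-congˡ (eᵢⱼ≈0 (u≢c₀ ∘ ≡.sym))) (zeroʳ _))) (+-identityˡ 1#)

        L⊙x : ∀ u → (L ⊙ x) u ≈ - N * L u c₀
        L⊙x u = begin
          L u · x
            ≈⟨ ·-linear (L u) (- N) (e c₀) ones ⟩
          - N * L u · e c₀ +ᴿ L u · ones
            ≈⟨ +-cong (*-congˡ (·e (L u) c₀)) (trans (L-ones u) (zeroˡ 1#)) ⟩
          - N * L u c₀ +ᴿ 0#
            ≈⟨ +-identityʳ _ ⟩
          - N * L u c₀ ∎

        T-centre : T c₀ ≈ - 1# +ᴿ N
        T-centre = begin
          T c₀                                  ≈⟨ T≈Σd̂ c₀ ⟩
          sum (d̂ c₀)                            ≈⟨ sum-cong entry ⟩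
          sum (λ v → - 1# * e c₀ v +ᴿ ones v)   ≈⟨ ·ones (λ v → - 1# * e c₀ v +ᴿ ones v) ⟨
          (λ v → - 1# * e c₀ v +ᴿ ones v) · ones ≈⟨ ·-comm (λ v → - 1# * e c₀ v +ᴿ ones v) ones ⟩
          ones · (λ v → - 1# * e c₀ v +ᴿ ones v) ≈⟨ ·-linear ones (- 1#) (e c₀) ones ⟩
          - 1# * ones · e c₀ +ᴿ ones · ones     ≈⟨ +-cong (trans (*-congˡ (·e ones c₀)) (*-identityʳ _)) ones·ones ⟩
          - 1# +ᴿ N                             ∎
          where
          entry′ : ∀ v → Dec (v ≡ c₀) → d̂ c₀ v ≈ - 1# * e c₀ v +ᴿ ones v
          entry′ v (yes ≡.refl) = trans (reflexive (≡.cong fromℕ (dist-refl G conn c₀)))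
            (sym (trans (+-congʳ (trans (*-congˡ (eᵢᵢ≈1 c₀)) (*-identityʳ _))) (-‿inverseˡ 1#)))
          entry′ v (no v≢c₀)    = trans (trans (d̂-sym c₀ v) (d̂c₀ v≢c₀))
            (sym (trans (+-congʳ (trans (*-congˡ (eᵢⱼ≈0 (v≢c₀ ∘ ≡.sym))) (zeroʳ _))) (+-identityˡ 1#)))
          entry : ∀ v → d̂ c₀ v ≈ - 1# * e c₀ v +ᴿ ones v
          entry v = entry′ v (v ≟ᶠ c₀)

        Lx≈Nx : ∀ u → Dec (u ≡ c₀) → (L ⊙ x) u ≈ N * x u
        Lx≈Nx u (yes ≡.refl) = begin
          (L ⊙ x) c₀
            ≈⟨ L⊙x c₀ ⟩
          - N * L c₀ c₀
            ≈⟨ *-congˡ (+-cong (trans (diag-e T c₀ c₀) (trans (*-congˡ (eᵢᵢ≈1 c₀)) (trans (*-identityʳ _) T-centre)))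
                 (trans (-‿cong (reflexive (≡.cong fromℕ (dist-refl G conn c₀)))) ε⁻¹≈ε)) ⟩
          - N * (- 1# +ᴿ N +ᴿ 0#)
            ≈⟨ trans (*-congˡ (+-identityʳ _)) (solve 2 (λ N o → (:- N) :* (:- o :+ N) := N :* ((:- N) :+ o)) refl N 1#) ⟩
          N * (- N +ᴿ 1#)
            ≈⟨ *-congˡ (+-congʳ (trans (*-congˡ (eᵢᵢ≈1 c₀)) (*-identityʳ _))) ⟨
          N * x c₀ ∎
        Lx≈Nx u (no u≢c₀) = begin
          (L ⊙ x) u
            ≈⟨ L⊙x u ⟩
          - N * L u c₀
            ≈⟨ *-congˡ (+-cong (trans (diag-e T u c₀) (trans (*-congˡ (eᵢⱼ≈0 u≢c₀)) (zeroʳ _))) (-‿cong (d̂c₀ u≢c₀))) ⟩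
          - N * (0# - 1#)
            ≈⟨ trans (*-congˡ (+-identityˡ _)) (solve 2 (λ N o → (:- N) :* (:- o) := N :* o) refl N 1#) ⟩
          N * 1#
            ≈⟨ *-congˡ (x-off-centre u≢c₀) ⟨
          N * x u ∎

        x≠0 : Nonzero x
        x≠0 with pendant-exists G conn G≇K 1≤p
        ... | u , pu = u , λ xᵤ≈0 → 1≉0 (trans (sym (x-off-centre λ { ≡.refl → ¬pc₀ pu })) xᵤ≈0)

      interval-nonempty : (σ : Spectrum L) → 1 ≤ m σ [ N , fromℕ (n + p) ⟩
      -- The eigenvalue n is the left end of the interval, which belongs to it because p ≥ 1 puts
      -- the right end strictly above.
      interval-nonempty σ = 0<count (λ y → (N ≤? y) ×-dec (y <? fromℕ (n + p))) (eigenvalue σ) (proj₁ N-eigenvalue)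
        (≤-reflexive (sym λᵢ≈N) , ≤-respˡ (sym λᵢ≈N) N≤b , λ λᵢ≈b → 0<n⇒fromℕ≰0 1≤p (≤-reflexive (p≈0 (trans (sym λᵢ≈N) λᵢ≈b))))
        where
        N-eigenvalue : ∃ λ i → eigenvalue σ i ≈ N
        N-eigenvalue = eigenvector⇒eigenvalue σ N {x} x≠0 (λ u → Lx≈Nx u (u ≟ᶠ c₀))
        λᵢ≈N = proj₂ N-eigenvalue
        p≈0 : N ≈ fromℕ (n + p) → fromℕ p ≈ 0#
        p≈0 N≈b = begin
          fromℕ p                   ≈⟨ solve 2 (λ N p → p := N :+ p :- N) refl N (fromℕ p) ⟩
          N +ᴿ fromℕ p - N          ≈⟨ +-congʳ (trans (sym (fromℕ-homo-+ n p)) (sym N≈b)) ⟩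
          N - N                     ≈⟨ -‿inverseʳ N ⟩
          0#                        ∎

theorem2p12 : ∀ {c ℓ₁ ℓ₂} (R : OrderedField c ℓ₁ ℓ₂) → let open Spectra R in
    ∀ (n p : ℕ) (G : Graph n) (conn : Connected G) →
    ¬ (G ≅ K n) → pendantCount G ≡ p → 1 ≤ p →
    (σ : Spectrum (distanceLaplacian G conn)) →
    (m σ [ fromℕ n , fromℕ (n + p) ⟩ ≤ n ∸ p)
    × (p ≡ n ∸ 1 → (m σ [ fromℕ n , fromℕ (n + p) ⟩ ≡ n ∸ p) ⇔ (G ≅ S n))
theorem2p12 R n p G conn G≇K ≡.refl 1≤p σ = bound , λ p≡n-1 → mk⇔
  (λ _ → isomorphic-star G≇K 1≤p p≡n-1 c₀ ¬pc₀)
  -- For p = n - 1 the bound n - p is 1, and the eigenvalue n attains it.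
  (λ _ → ℕₚ.≤-antisym bound (ℕₚ.≤-trans (ℕₚ.≤-reflexive (n∸p≡1 p≡n-1)) (interval-nonempty G≇K 1≤p p≡n-1 c₀ ¬pc₀ σ)))
  where
  open DistanceLaplacian R G conn
  bound = pendant-interval-bound G≇K 1≤p σ
  c₀ = proj₁ (nonpendant-exists G conn G≇K 1≤p)
  ¬pc₀ = proj₂ (nonpendant-exists G conn G≇K 1≤p)
  n∸p≡1 : p ≡ n ∸ 1 → n ∸ p ≡ 1
  n∸p≡1 p≡n-1 = ≡.trans (≡.cong (n ∸_) p≡n-1)
    (ℕₚ.m∸[m∸n]≡n (ℕₚ.≤-trans 1≤p (ℕₚ.<⇒≤ (pendantCount<n G conn G≇K 1≤p))))
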